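{- Let $G$ be a finite graph with $\gamma(G)=\gamma^{\infty}(G)$ and maximum degree $\Delta(G)\leq 3$. Then $\gamma^{\infty}(G)=\theta(G)$.
   Context: All graphs are finite, simple and undirected. A dominating set of $G=(V,E)$ is a set $D\subseteq V$ such that every vertex of $V-D$ is adjacent to a vertex of $D$; $\gamma(G)$ is the minimum size of a dominating set. Eternal domination ("one guard moves"): a defender chooses a set $D_1\subseteq V$ and places one guard on each vertex of $D_1$. Then, for $i=1,2,\ldots$ in turn, an attacker (knowing the current position) chooses a vertex $r_i\in V-D_i$, and the defender responds by moving exactly one guard to $r_i$ from an adjacent vertex $v\in D_i$, so that $D_{i+1}=(D_i-\{v\})\cup\{r_i\}$. Every $D_i$ must be a dominating set. $D_1$ is an eternal dominating set (EDS) if the defender, starting from $D_1$, can respond in this way forever to every infinite sequence of attacks. The eternal domination number $\gamma^{\infty}(G)$ is the minimum size of an EDS of $G$. The clique covering number $\theta(G)$ is the minimum number $k$ of sets in a partition $V=V_1\cup\cdots\cup V_k$ such that each induced subgraph $G[V_i]$ is complete. -}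

module Defs where

open import Data.Fin.Base using (Fin; finToFun; funToFin)
open import Data.Fin.Properties using (_≟_; any?; all?; finToFun-funToFin)
open import Data.Fin.Subset using (Subset; inside; outside; _∈_; _∉_; ∣_∣; _-_; _∪_; ⁅_⁆; ⊤)
open import Data.Fin.Subset.Properties using (_∈?_; ∈⊤; anySubset?)
open import Data.List.Base as List using (List; []; _∷_; [_]; _++_; applyUpTo; filter; length; allFin)
open import Data.List.Extrema.Nat using (max)
import Data.List.Membership.Propositional as Mem
open import Data.List.Membership.Propositional.Properties using (∈-++⁺ˡ; ∈-++⁺ʳ; ∈-map⁺; ∈-filter⁺)
open import Data.List.Properties using (filter-notAll)
open import Data.List.Relation.Unary.All as All using (All)
open import Data.List.Relation.Unary.All.Properties using (¬All⇒Any¬)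
open import Data.List.Relation.Unary.Any using (here)
open import Data.Nat.Base using (ℕ; zero; suc; _≤_; _<_; z≤n; s≤s)
open import Data.Nat.Induction using (Acc; acc; <-wellFounded)
import Data.Nat.Properties as ℕ
open import Data.Product.Base using (∃; _×_; _,_; proj₁; proj₂)
open import Data.Vec.Base as Vec using (tabulate)
open import Data.Vec.Properties using (≡-dec)
import Data.Bool.Properties as Bool
open import Function.Base using (const)
open import Level using (0ℓ)
open import Relation.Binary.Core using (Rel)
open import Relation.Binary.Definitions using (Decidable; Symmetric; Irreflexive)
open import Relation.Binary.PropositionalEquality using (_≡_; _≢_; refl; sym; trans; cong; subst)
open import Relation.Nullary using (Dec; yes; no; does; contradiction; ¬?; map′; _×-dec_; _→-dec_)
import Relation.Unary as U

private
  variable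
    n : ℕ

record Graph (n : ℕ) : Set₁ where
  infix 4 _~_ _~?_
  field
    _~_      : Rel (Fin n) 0ℓ
    _~?_     : Decidable _~_
    ~-sym    : Symmetric _~_
    ~-irrefl : Irreflexive _≡_ _~_

IsMinimum : (ℕ → Set) → ℕ → Set
IsMinimum P k = P k × (∀ {j} → P j → k ≤ j)

minimum : {P : ℕ → Set} → U.Decidable P → ∃ P → ∃ (IsMinimum P)
minimum {P} P? (m , Pm) = search P P? m Pm
  where
  search : (Q : ℕ → Set) → U.Decidable Q → ∀ m → Q m → ∃ (IsMinimum Q)
  search Q Q? m Qm with Q? zero
  search Q Q? m       Qm | yes q0 = zero , q0 , const z≤n
  search Q Q? zero    Qm | no ¬q0 = contradiction Qm ¬q0
  search Q Q? (suc m) Qm | no ¬q0 with search (λ i → Q (suc i)) (λ i → Q? (suc i)) m Qm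
  ... | k , qk , least = suc k , qk , λ {j} → bound j
    where
    bound : ∀ j → Q j → suc k ≤ j
    bound zero    q0 = contradiction q0 ¬q0
    bound (suc j) qj = s≤s (least qj)

-- On subset D the guard at v moves to r.
move : Subset n → Fin n → Fin n → Subset n
move D v r = (D - v) ∪ ⁅ r ⁆

-- A defender sees the earlier attacks (oldest first), the current position
-- and the current attack, but no later attack, and names the vertex whose
-- guard moves.
Strategy : ℕ → Set
Strategy n = List (Fin n) → Subset n → Fin n → Fin n

module _ (σ : Strategy n) (D₁ : Subset n) (r : ℕ → Fin n) where

  -- Rounds are counted from 0, so position i is the set written D with
  -- subscript i + 1, and r i is the attack made on it.
  position : ℕ → Subset n
  response : ℕ → Fin n

  position zero    = D₁
  position (suc i) = move (position i) (response i) (r i)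

  response i = σ (applyUpTo r i) (position i) (r i)

  LegalBefore : ℕ → Set
  LegalBefore i = ∀ {j} → j < i → r j ∉ position j

module _ (G : Graph n) where
  open Graph G

  neighbours : Fin n → Subset n
  neighbours v = tabulate λ u → does (v ~? u)

  degree : Fin n → ℕ
  degree v = ∣ neighbours v ∣

  Δ : ℕ
  Δ = max 0 (List.map degree (allFin n))

  Dominating : Subset n → Set
  Dominating D = ∀ v → v ∉ D → ∃ λ u → u ∈ D × v ~ u

  -- Legality of the attacks is required only up to the round in question.
  -- Restricting to sequences that are legal throughout would be wrong: an
  -- illegal response can create a guard, and once every vertex is occupied
  -- no legal attack remains, which would excuse that response.
  Defends : Strategy n → Subset n → Set
  Defends σ D₁ = ∀ r i → LegalBefore σ D₁ r i →
    let D = position σ D₁ r i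
        v = response σ D₁ r i
    in Dominating D × (r i ∉ D → v ∈ D × v ~ r i)

  EternalDominating : Subset n → Set
  EternalDominating D₁ = ∃ λ σ → Defends σ D₁

  -- The part with index i is the fibre of p over i. Parts may be empty, which
  -- does not affect the minimum number of parts.
  IsCliquePartition : ∀ {k} → (Fin n → Fin k) → Set
  IsCliquePartition p = ∀ u v → p u ≡ p v → u ≢ v → u ~ v

  HasDominatingSet HasEternalDominatingSet HasCliquePartition : ℕ → Set
  HasDominatingSet        k = ∃ λ D → ∣ D ∣ ≡ k × Dominating D
  HasEternalDominatingSet k = ∃ λ D → ∣ D ∣ ≡ k × EternalDominating D
  HasCliquePartition      k = ∃ λ (p : Fin n → Fin k) → IsCliquePartition p

  dominating? : U.Decidable Dominating
  dominating? D = all? λ v → ¬? (v ∈? D) →-dec any? λ u → (u ∈? D) ×-dec (v ~? u)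

  hasDominatingSet? : U.Decidable HasDominatingSet
  hasDominatingSet? k = anySubset? λ D → (∣ D ∣ ℕ.≟ k) ×-dec dominating? D

  isCliquePartition? : ∀ {k} → U.Decidable (IsCliquePartition {k})
  isCliquePartition? p = all? λ u → all? λ v →
    (p u ≟ p v) →-dec (¬? (u ≟ v) →-dec (u ~? v))

  hasCliquePartition? : U.Decidable HasCliquePartition
  hasCliquePartition? k = map′
    (λ (c , h) → finToFun c , h)
    (λ (p , h) → funToFin p , λ u v eq → h u v
      (trans (sym (finToFun-funToFin p u)) (trans eq (finToFun-funToFin p v))))
    (any? λ c → isCliquePartition? (finToFun {k} {n} c))

  eternal⇒dominating : ∀ {D} → EternalDominating D → Dominating D
  eternal⇒dominating (σ , def) v = proj₁ (def (const v) 0 λ ()) v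

  eternal⇒response : ∀ {D} → EternalDominating D → ∀ r → r ∉ D →
    ∃ λ v → v ∈ D × v ~ r × EternalDominating (move D v r)
  eternal⇒response {D} (σ , def) r₀ r₀∉D = v , proj₁ ok , proj₂ ok , σ′ , def′
    where
    v  = σ [] D r₀
    ok = proj₂ (def (const r₀) 0 λ ()) r₀∉D

    σ′ : Strategy n
    σ′ rs = σ (r₀ ∷ rs)

    prepend : (ℕ → Fin n) → ℕ → Fin n
    prepend r zero    = r₀
    prepend r (suc i) = r i

    shift : ∀ r i → position σ′ (move D v r₀) r i ≡ position σ D (prepend r) (suc i)
    shift r zero    = refl
    shift r (suc i) = cong (λ E → move E (σ′ (applyUpTo r i) E (r i)) (r i)) (shift r i)

    def′ : Defends σ′ (move D v r₀)
    def′ r i legal = subst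
      (λ E → Dominating E × (r i ∉ E → σ′ (applyUpTo r i) E (r i) ∈ E
                                        × σ′ (applyUpTo r i) E (r i) ~ r i))
      (sym (shift r i))
      (def (prepend r) (suc i) λ {j} → legal′ j)
      where
      legal′ : ∀ j → j < suc i → prepend r j ∉ position σ D (prepend r) j
      legal′ zero    _         = r₀∉D
      legal′ (suc j) (s≤s j<i) = subst (r j ∉_) (shift r j) (legal j<i)

  -- Eternal domination is decided by starting from all subsets and repeatedly
  -- discarding those from which some attack cannot be answered within the
  -- remaining family.
  private
    _≟ˢ_ : Decidable {A = Subset n} _≡_
    _≟ˢ_ = ≡-dec Bool._≟_

    open import Data.List.Membership.DecPropositional _≟ˢ_ using () renaming (_∈?_ to _∈ₗ?_)

    Safe : List (Subset n) → Subset n → Set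
    Safe F D = Dominating D ×
      (∀ r → r ∉ D → ∃ λ v → v ∈ D × v ~ r × move D v r Mem.∈ F)

    safe? : ∀ F → U.Decidable (Safe F)
    safe? F D = dominating? D ×-dec all? λ r → ¬? (r ∈? D) →-dec
      any? λ v → (v ∈? D) ×-dec ((v ~? r) ×-dec (move D v r ∈ₗ? F))

    safe⇒eternal : ∀ F → All (Safe F) F → ∀ {D} → D Mem.∈ F → EternalDominating D
    safe⇒eternal F safe {D₁} D₁∈F = σ , def
      where
      choose : ∀ D r → Dec (D Mem.∈ F) → Dec (r ∈ D) → Fin n
      choose D r (yes D∈F) (no r∉D) = proj₁ (proj₂ (All.lookup safe D∈F) r r∉D)
      choose D r _         _        = r

      σ : Strategy n
      σ _ D r = choose D r (D ∈ₗ? F) (r ∈? D)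

      choose-ok : ∀ D r → D Mem.∈ F → r ∉ D → ∀ d e → let v = choose D r d e in
        v ∈ D × v ~ r × move D v r Mem.∈ F
      choose-ok D r D∈F r∉D (yes p) (no q)  = proj₂ (proj₂ (All.lookup safe p) r q)
      choose-ok D r D∈F r∉D (yes p) (yes q) = contradiction q r∉D
      choose-ok D r D∈F r∉D (no p)  e       = contradiction D∈F p

      ok : ∀ D r → D Mem.∈ F → r ∉ D → let v = σ [] D r in
        v ∈ D × v ~ r × move D v r Mem.∈ F
      ok D r D∈F r∉D = choose-ok D r D∈F r∉D (D ∈ₗ? F) (r ∈? D)

      stays : ∀ r i → LegalBefore σ D₁ r i → position σ D₁ r i Mem.∈ F
      stays r zero    _     = D₁∈F
      stays r (suc i) legal = proj₂ (proj₂ (ok (position σ D₁ r i) (r i)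
        (stays r i λ j<i → legal (ℕ.m<n⇒m<1+n j<i)) (legal ℕ.≤-refl)))

      def : Defends σ D₁
      def r i legal = proj₁ (All.lookup safe (stays r i legal)) , λ r∉D →
        let a , b , _ = ok (position σ D₁ r i) (r i) (stays r i legal) r∉D in a , b

    Complete : List (Subset n) → Set
    Complete F = ∀ {D} → EternalDominating D → D Mem.∈ F

    eternal⇒safe : ∀ {F} → Complete F → ∀ {D} → EternalDominating D → Safe F D
    eternal⇒safe complete e = eternal⇒dominating e , λ r r∉D →
      let v , v∈D , v~r , e′ = eternal⇒response e r r∉D in v , v∈D , v~r , complete e′

    prune : ∀ F → Acc _<_ (length F) → Complete F → ∃ λ F′ → All (Safe F′) F′ × Complete F′
    prune F (acc rec) complete with All.all? (safe? F) F
    ... | yes safe = F , safe , complete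
    ... | no ¬safe = prune (filter (safe? F) F)
      (rec (filter-notAll (safe? F) F (¬All⇒Any¬ (safe? F) F ¬safe)))
      (λ e → ∈-filter⁺ (safe? F) (complete e) (eternal⇒safe complete e))

    subsets : ∀ m → List (Subset m)
    subsets zero    = [ Vec.[] ]
    subsets (suc m) = List.map (inside Vec.∷_) (subsets m) ++ List.map (outside Vec.∷_) (subsets m)

    ∈-subsets : ∀ {m} (D : Subset m) → D Mem.∈ subsets m
    ∈-subsets Vec.[]            = here refl
    ∈-subsets (inside  Vec.∷ D) = ∈-++⁺ˡ (∈-map⁺ _ (∈-subsets D))
    ∈-subsets (outside Vec.∷ D) = ∈-++⁺ʳ _ (∈-map⁺ _ (∈-subsets D))

  eternalDominating? : U.Decidable EternalDominating
  eternalDominating? D =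
    let F , safe , complete = prune (subsets n) (<-wellFounded _) (λ {E} _ → ∈-subsets E)
    in map′ (safe⇒eternal F safe) complete (D ∈ₗ? F)

  hasEternalDominatingSet? : U.Decidable HasEternalDominatingSet
  hasEternalDominatingSet? k = anySubset? λ D → (∣ D ∣ ℕ.≟ k) ×-dec eternalDominating? D

  ⊤-dominating : Dominating ⊤
  ⊤-dominating v v∉⊤ = contradiction ∈⊤ v∉⊤

  ⊤-eternalDominating : EternalDominating ⊤
  ⊤-eternalDominating = (λ _ _ r → r) , λ where
    r zero    _     → ⊤-dominating , λ r∉⊤ → contradiction ∈⊤ r∉⊤
    r (suc i) legal → contradiction ∈⊤ (legal {0} (s≤s z≤n))

  private
    γ-exists : ∃ (IsMinimum HasDominatingSet)
    γ-exists = minimum hasDominatingSet? (_ , ⊤ , refl , ⊤-dominating)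

    γ∞-exists : ∃ (IsMinimum HasEternalDominatingSet)
    γ∞-exists = minimum hasEternalDominatingSet? (_ , ⊤ , refl , ⊤-eternalDominating)

    θ-exists : ∃ (IsMinimum HasCliquePartition)
    θ-exists = minimum hasCliquePartition? (n , (λ v → v) , λ u v u≡v u≢v → contradiction u≡v u≢v)

  γ γ∞ θ : ℕ
  γ  = proj₁ γ-exists
  γ∞ = proj₁ γ∞-exists
  θ  = proj₁ θ-exists

  γ-isMinimum : IsMinimum HasDominatingSet γ
  γ-isMinimum = proj₂ γ-exists

  γ∞-isMinimum : IsMinimum HasEternalDominatingSet γ∞
  γ∞-isMinimum = proj₂ γ∞-exists

  θ-isMinimum : IsMinimum HasCliquePartition θ
  θ-isMinimum = proj₂ θ-exists

{-# OPTIONS --safe #-}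
module Submission where

-- Let k = γ = γ∞. Attacking the vertices of a maximal independent set one after
-- the other shows that some winning position I with k guards is independent.
-- The guard v that answers an attack on y ∉ I must be a friend of y: y is
-- adjacent to v and to all private neighbours of v. Hence it suffices to assign
-- to each y ∉ I a friend in such a way that any two vertices assigned to the
-- same guard are adjacent; the fibres then form k cliques. As degrees are at
-- most 3 and no k - 1 vertices dominate, conflicts are local: two nonadjacent
-- vertices with the same friend can be assigned consistently, or else a short
-- sequence of attacks defeats the defender.

open import Data.Empty using (⊥; ⊥-elim)
open import Data.Fin.Base using (Fin; zero; suc; _<_)
open import Data.Fin.Properties using (_≟_; any?; all?; <-asym; <-cmp; _<?_; injective⇒≤; suc-injective; ¬∀⟶∃¬-smallest)
open import Data.Fin.Subset using (Subset; inside; outside; _∈_; _∉_; ∣_∣; _-_; _∪_; ⁅_⁆)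
open import Data.Fin.Subset.Properties
  using (_∈?_; p─q⊆p; x∈p∧x≢y⇒x∈p-y; x∈p⇒∣p-x∣<∣p∣; x∈p∪q⁺; x∈p∪q⁻; x∈⁅x⁆; x∈⁅y⁆⇒x≡y; ∪-identityʳ)
open import Data.List.Base as List using ([]; _∷_; allFin)
open import Data.List.Extrema.Nat using (xs≤max)
import Data.List.Membership.Propositional as Mem
open import Data.List.Membership.Propositional.Properties using (∈-map⁺; ∈-allFin)
import Data.List.Relation.Unary.All as All
open import Data.List.Relation.Unary.Any using (here; there)
open import Data.Nat.Base as ℕ using (ℕ; z≤n; s≤s; _≤_)
import Data.Nat.Properties as ℕ
open import Data.Product.Base using (∃; _×_; _,_; proj₁; proj₂)
open import Data.Sum.Base using (_⊎_; inj₁; inj₂; [_,_]′; swap)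
import Data.Vec.Base as Vec
open import Data.Vec.Properties using (lookup∘tabulate; lookup⇒[]=; []=⇒lookup)
open import Function.Base using (_∘_)
open import Relation.Binary.Definitions using (tri<; tri≈; tri>)
open import Relation.Binary.PropositionalEquality using (_≡_; _≢_; refl; sym; trans; cong; subst; ≢-sym)
open import Relation.Nullary using (¬_; Dec; does; yes; no; contradiction; ¬?; _×-dec_; _→-dec_; _⊎-dec_)
open import Relation.Nullary.Decidable using (dec-true; decidable-stable)
open import Defs

-- The answers of the defender depend on the position, so they yield a friend for each `y` but no
-- consistent choice. Consistency is obtained from a relation `Claim` instead: every `y ∉ I` claims
-- some guard, and nonadjacent vertices never claim the same one, so any choice of claims gives
-- cliques. Three kinds of `y` occur. If a friend of `y` has a private neighbour, a conflict forces
-- a whole component on five vertices, which two cliques cover. If `y` has a single friend and this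
-- friend has no private neighbour, conflicts are impossible; this needs the longest line of attack.
-- If `y` has two friends, both without private neighbours, these are its only neighbours in `I`,
-- and minimality of `k` supplies a further, nonadjacent vertex between the same two guards; such
-- extra vertices are what exhausts the degree bound.

private
  variable
    n : ℕ

-- Subsets, guard moves and least elements

∈-minus⁻ : ∀ {D : Subset n} {u v} → u ∈ D - v → u ∈ D × u ≢ v
∈-minus⁻ {D = D} {u} {v} u∈D-v = p─q⊆p D ⁅ v ⁆ u∈D-v , λ { refl → absent D u u∈D-v }
  where
  absent : ∀ {m} (E : Subset m) x → x ∉ E - x
  absent (inside  Vec.∷ E) zero    ()
  absent (outside Vec.∷ E) zero    ()
  absent (_       Vec.∷ E) (suc x) (Vec.there x∈) = absent E x x∈

∣∪⁅⁆∣≤ : (D : Subset n) (r : Fin n) → ∣ D ∪ ⁅ r ⁆ ∣ ≤ ℕ.suc ∣ D ∣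
∣∪⁅⁆∣≤ {ℕ.suc n} (inside  Vec.∷ D) zero    = s≤s (ℕ.m≤n⇒m≤1+n (ℕ.≤-reflexive (cong ∣_∣ (∪-identityʳ D))))
∣∪⁅⁆∣≤ {ℕ.suc n} (outside Vec.∷ D) zero    = s≤s (ℕ.≤-reflexive (cong ∣_∣ (∪-identityʳ D)))
∣∪⁅⁆∣≤ {ℕ.suc n} (inside  Vec.∷ D) (suc r) = s≤s (∣∪⁅⁆∣≤ D r)
∣∪⁅⁆∣≤ {ℕ.suc n} (outside Vec.∷ D) (suc r) = ∣∪⁅⁆∣≤ D r

∈-move⁻ : ∀ {D : Subset n} {v r u} → u ∈ move D v r → u ≡ r ⊎ (u ∈ D × u ≢ v)
∈-move⁻ {D = D} {v} {r} u∈ with x∈p∪q⁻ (D - v) ⁅ r ⁆ u∈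
... | inj₁ u∈D-v = inj₂ (∈-minus⁻ u∈D-v)
... | inj₂ u∈⁅r⁆ = inj₁ (x∈⁅y⁆⇒x≡y r u∈⁅r⁆)

∈-move-new : ∀ {D : Subset n} {v r} → r ∈ move D v r
∈-move-new {r = r} = x∈p∪q⁺ (inj₂ (x∈⁅x⁆ r))

∈-move-old : ∀ {D : Subset n} {v r u} → u ∈ D → u ≢ v → u ∈ move D v r
∈-move-old u∈D u≢v = x∈p∪q⁺ (inj₁ (x∈p∧x≢y⇒x∈p-y u∈D u≢v))

∣move∣≤ : ∀ {D : Subset n} {v r} → v ∈ D → ∣ move D v r ∣ ≤ ∣ D ∣
∣move∣≤ {D = D} {v} {r} v∈D = ℕ.≤-trans (∣∪⁅⁆∣≤ (D - v) r) (x∈p⇒∣p-x∣<∣p∣ v∈D)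

∈-tabulate⁺ : {P : Fin n → Set} (P? : ∀ v → Dec (P v)) → ∀ {v} → P v → v ∈ Vec.tabulate (λ u → does (P? u))
∈-tabulate⁺ P? {v} Pv = lookup⇒[]= v _ (trans (lookup∘tabulate _ v) (dec-true (P? v) Pv))

∈-tabulate⁻ : {P : Fin n → Set} (P? : ∀ v → Dec (P v)) → ∀ {v} → v ∈ Vec.tabulate (λ u → does (P? u)) → P v
∈-tabulate⁻ {P = P} P? {v} v∈ = holds (P? v) (trans (sym (lookup∘tabulate _ v)) ([]=⇒lookup v∈))
  where
  holds : (d : Dec (P v)) → does d ≡ inside → P v
  holds (yes Pv) _ = Pv
  holds (no _)   ()

member : (D : Subset n) → Fin ∣ D ∣ → Fin n
member (inside  Vec.∷ D) zero    = zero
member (inside  Vec.∷ D) (suc i) = suc (member D i)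
member (outside Vec.∷ D) i       = suc (member D i)

member-∈ : (D : Subset n) (i : Fin ∣ D ∣) → member D i ∈ D
member-∈ (inside  Vec.∷ D) zero    = Vec.here
member-∈ (inside  Vec.∷ D) (suc i) = Vec.there (member-∈ D i)
member-∈ (outside Vec.∷ D) i       = Vec.there (member-∈ D i)

member-injective : (D : Subset n) {i j : Fin ∣ D ∣} → member D i ≡ member D j → i ≡ j
member-injective (inside  Vec.∷ D) {zero}  {zero}  _  = refl
member-injective (inside  Vec.∷ D) {suc i} {suc j} eq = cong suc (member-injective D (suc-injective eq))
member-injective (outside Vec.∷ D)                 eq = member-injective D (suc-injective eq)

index : {D : Subset n} {x : Fin n} → x ∈ D → ∃ λ i → member D i ≡ x
index {D = inside  Vec.∷ D} Vec.here = zero , refl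
index {D = inside  Vec.∷ D} (Vec.there x∈D) with i , refl ← index x∈D = suc i , refl
index {D = outside Vec.∷ D} (Vec.there x∈D) with i , refl ← index x∈D = i , refl

least : {P : Fin n → Set} → (∀ i → Dec (P i)) → ∃ P → ∃ λ m → P m × (∀ i → i < m → ¬ P i)
least {ℕ.suc n} {P} P? (i , Pi) with P? zero
... | yes P0 = zero , P0 , λ _ ()
least {ℕ.suc n} {P} P? (zero , P0) | no ¬P0 = contradiction P0 ¬P0
least {ℕ.suc n} {P} P? (suc i , Pi) | no ¬P0 with m , Pm , below ← least (λ j → P? (suc j)) (i , Pi) =
  suc m , Pm , λ { zero _ → ¬P0 ; (suc j) (s≤s j<m) → below j j<m }

-- Clique partitions and dominating sets

module _ (G : Graph n) where
  open Graph G

  -- The least vertex of each nonempty part dominates that part. This gives `γ ≤ θ`, which under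
  -- `γ = γ∞` is the easy half of the theorem.
  clique-partition⇒dominating : ∀ {m} → HasCliquePartition G m → ∃ λ D → ∣ D ∣ ≤ m × Dominating G D
  clique-partition⇒dominating (p , clique) = D , injective⇒≤ p∘member-injective , D-dominating
    where
    First : Fin n → Set
    First v = ∀ u → u < v → p u ≢ p v

    first? : ∀ v → Dec (First v)
    first? v = all? λ u → (u <? v) →-dec ¬? (p u ≟ p v)

    D : Subset n
    D = Vec.tabulate λ v → does (first? v)

    First⇒∈ : ∀ {v} → First v → v ∈ D
    First⇒∈ = ∈-tabulate⁺ first?

    ∈⇒First : ∀ {v} → v ∈ D → First v
    ∈⇒First = ∈-tabulate⁻ first?

    D-dominating : Dominating G D
    D-dominating v v∉D with least (λ u → p u ≟ p v) (v , refl)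
    ... | m , pm≡pv , below = m , m∈D , clique v m (sym pm≡pv) (λ { refl → v∉D m∈D })
      where
      m∈D = First⇒∈ λ u u<m pu≡pm → below u u<m (trans pu≡pm pm≡pv)

    p∘member-injective : ∀ {i j} → p (member D i) ≡ p (member D j) → i ≡ j
    p∘member-injective {i} {j} eq with <-cmp (member D i) (member D j)
    ... | tri< lt _ _ = contradiction eq (∈⇒First (member-∈ D j) _ lt)
    ... | tri≈ _ e _  = member-injective D e
    ... | tri> _ _ gt = contradiction (sym eq) (∈⇒First (member-∈ D i) _ gt)

degree≤Δ : (G : Graph n) → ∀ v → degree G v ≤ Δ G
degree≤Δ {n} G v = All.lookup (xs≤max 0 (List.map (degree G) (allFin n))) (∈-map⁺ (degree G) (∈-allFin v))

-- Play with as few guards as domination allows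

module Play (G : Graph n) (degree≤3 : ∀ v → degree G v ≤ 3) (k : ℕ) (γ≥k : ∀ D → Dominating G D → k ≤ ∣ D ∣) where
  open Graph G

  ~⇒≢ : ∀ {u v} → u ~ v → u ≢ v
  ~⇒≢ u~v u≡v = ~-irrefl u≡v u~v

  four-neighbours : ∀ {v a b c d} → v ~ a → v ~ b → v ~ c → v ~ d →
    a ≢ b → a ≢ c → a ≢ d → b ≢ c → b ≢ d → c ≢ d → ⊥
  four-neighbours {v} {a} {b} {c} {d} va vb vc vd a≢b a≢c a≢d b≢c b≢d c≢d =
    ℕ.<⇒≱ (ℕ.<-≤-trans (ℕ.≤-<-trans (ℕ.≤-trans (s≤s (ℕ.≤-trans (s≤s (ℕ.≤-trans (s≤s z≤n)
      (x∈p⇒∣p-x∣<∣p∣ d∈))) (x∈p⇒∣p-x∣<∣p∣ c∈))) (x∈p⇒∣p-x∣<∣p∣ b∈)) (x∈p⇒∣p-x∣<∣p∣ a∈)) (degree≤3 v)) ℕ.≤-refl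
    where
    N = neighbours G v
    ∈N : ∀ {u} → v ~ u → u ∈ N
    ∈N = ∈-tabulate⁺ (v ~?_)
    a∈ : a ∈ N
    a∈ = ∈N va
    b∈ : b ∈ N - a
    b∈ = x∈p∧x≢y⇒x∈p-y (∈N vb) (≢-sym a≢b)
    c∈ : c ∈ N - a - b
    c∈ = x∈p∧x≢y⇒x∈p-y (x∈p∧x≢y⇒x∈p-y (∈N vc) (≢-sym a≢c)) (≢-sym b≢c)
    d∈ : d ∈ N - a - b - c
    d∈ = x∈p∧x≢y⇒x∈p-y (x∈p∧x≢y⇒x∈p-y (x∈p∧x≢y⇒x∈p-y (∈N vd) (≢-sym a≢d)) (≢-sym b≢d)) (≢-sym c≢d)

  three-neighbours : ∀ {v a b c d} → v ~ a → v ~ b → v ~ c → a ≢ b → a ≢ c → b ≢ c →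
    v ~ d → d ≡ a ⊎ d ≡ b ⊎ d ≡ c
  three-neighbours {v} {a} {b} {c} {d} va vb vc a≢b a≢c b≢c vd with d ≟ a | d ≟ b | d ≟ c
  ... | yes d≡a | _       | _       = inj₁ d≡a
  ... | no _    | yes d≡b | _       = inj₂ (inj₁ d≡b)
  ... | no _    | no _    | yes d≡c = inj₂ (inj₂ d≡c)
  ... | no d≢a  | no d≢b  | no d≢c  =
    ⊥-elim (four-neighbours va vb vc vd a≢b a≢c (≢-sym d≢a) b≢c (≢-sym d≢b) (≢-sym d≢c))

  infix 4 _≃_ _≃?_

  _≃_ : Fin n → Fin n → Set
  u ≃ v = u ≡ v ⊎ u ~ v

  _≃?_ : ∀ u v → Dec (u ≃ v)
  u ≃? v = (u ≟ v) ⊎-dec (u ~? v)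

  ≃-sym : ∀ {u v} → u ≃ v → v ≃ u
  ≃-sym (inj₁ u≡v) = inj₁ (sym u≡v)
  ≃-sym (inj₂ u~v) = inj₂ (~-sym u~v)

  undominated : ∀ S → ∣ S ∣ ℕ.< k → ∃ λ y → ∀ {u} → u ∈ S → ¬ y ≃ u
  undominated S ∣S∣<k with all? (λ y → any? λ u → (u ∈? S) ×-dec (y ≃? u))
  ... | no ¬all with y , ¬y , _ ← ¬∀⟶∃¬-smallest n _ (λ y → any? λ u → (u ∈? S) ×-dec (y ≃? u)) ¬all =
    y , λ u∈S y≃u → ¬y (_ , u∈S , y≃u)
  ... | yes all = contradiction (γ≥k S dominating) (ℕ.<⇒≱ ∣S∣<k)
    where
    dominating : Dominating G S
    dominating y y∉S with all y
    ... | u , u∈S , inj₁ refl = contradiction u∈S y∉S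
    ... | u , u∈S , inj₂ y~u  = u , u∈S , y~u

  -- An upper bound on the size is what a move preserves at once; `γ≥k` supplies the reverse
  -- inequality.
  record Winning (D : Subset n) : Set where
    constructor winning
    field
      eternal : EternalDominating G D
      size    : ∣ D ∣ ≤ k

  covered : ∀ {D} → Winning D → ∀ y → ∃ λ u → u ∈ D × y ≃ u
  covered {D} (winning eternal _) y with y ∈? D
  ... | yes y∈D = y , y∈D , inj₁ refl
  ... | no y∉D with u , u∈D , y~u ← eternal⇒dominating G eternal y y∉D = u , u∈D , inj₂ y~u

  respond : ∀ {D} → Winning D → ∀ r → r ∉ D → ∃ λ v → v ∈ D × v ~ r × Winning (move D v r)
  respond (winning eternal ∣D∣≤k) r r∉D with v , v∈D , v~r , eternal′ ← eternal⇒response G eternal r r∉D =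
    v , v∈D , v~r , winning eternal′ (ℕ.≤-trans (∣move∣≤ v∈D) ∣D∣≤k)

  remove : ∀ {D g} → Winning D → g ∈ D → ∃ λ y → ∀ {u} → u ∈ D → u ≢ g → ¬ y ≃ u
  remove {D} {g} (winning _ ∣D∣≤k) g∈D
    with y , far ← undominated (D - g) (ℕ.<-≤-trans (x∈p⇒∣p-x∣<∣p∣ g∈D) ∣D∣≤k) =
    y , λ u∈D u≢g → far (x∈p∧x≢y⇒x∈p-y u∈D u≢g)

  -- Trading two guards for one on `w` leaves fewer than `k` vertices, too few to dominate.
  merge : ∀ {D g b} → Winning D → g ∈ D → b ∈ D → g ≢ b → ∀ w →
    ∃ λ y → ¬ y ≃ w × (∀ {u} → u ∈ D → u ≢ g → u ≢ b → ¬ y ≃ u)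
  merge {D} {g} {b} (winning _ ∣D∣≤k) g∈D b∈D g≢b w
    with y , far ← undominated (move (D - g) b w)
      (ℕ.≤-<-trans (∣move∣≤ (x∈p∧x≢y⇒x∈p-y b∈D (≢-sym g≢b))) (ℕ.<-≤-trans (x∈p⇒∣p-x∣<∣p∣ g∈D) ∣D∣≤k)) =
    y , far ∈-move-new , λ u∈D u≢g u≢b → far (∈-move-old (x∈p∧x≢y⇒x∈p-y u∈D u≢g) u≢b)

  -- Reaching an independent winning position

  Independent : Subset n → Set
  Independent D = ∀ {u v} → u ∈ D → v ∈ D → ¬ u ~ v

  occupy : ∀ {D} → Winning D → ∀ v → ∃ λ D₁ → Winning D₁ × v ∈ D₁ × (∀ {u} → u ∈ D → ¬ v ≃ u → u ∈ D₁)
  occupy {D} win v with v ∈? D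
  ... | yes v∈D = D , win , v∈D , λ u∈D _ → u∈D
  ... | no v∉D with s , s∈D , s~v , win₁ ← respond win v v∉D =
    move D s v , win₁ , ∈-move-new , λ { u∈D v≄u → ∈-move-old u∈D λ { refl → v≄u (inj₂ (~-sym s~v)) } }

  -- Attacking the vertices of an independent set J one after the other drives
  -- guards onto all of J, since no guard on J can answer an attack on J.
  sweep : ∀ vs J {D} → Winning D → (∀ {u} → u Mem.∈ J → u ∈ D) →
    (∀ {u v} → u Mem.∈ J → v Mem.∈ J → ¬ u ~ v) →
    ∃ λ D′ → Winning D′ × ∃ λ J′ → (∀ {u} → u Mem.∈ J′ → u ∈ D′) ×
      (∀ {u v} → u Mem.∈ J′ → v Mem.∈ J′ → ¬ u ~ v) ×
      (∀ {u} → u Mem.∈ J → u Mem.∈ J′) × (∀ {v} → v Mem.∈ vs → ∃ λ u → u Mem.∈ J′ × v ≃ u)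
  sweep [] J win J⊆D indep = _ , win , J , J⊆D , indep , (λ u∈J → u∈J) , λ ()
  sweep (v ∷ vs) J {D} win J⊆D indep with any? (λ u → (u ∈ₗ? J) ×-dec (v ≃? u))
    where open import Data.List.Membership.DecPropositional (_≟_ {n}) using () renaming (_∈?_ to _∈ₗ?_)
  ... | yes (u , u∈J , v≃u) with D′ , win′ , J′ , J′⊆D′ , indep′ , J⊆J′ , dom ← sweep vs J win J⊆D indep =
    D′ , win′ , J′ , J′⊆D′ , indep′ , J⊆J′ , λ { (here refl) → u , J⊆J′ u∈J , v≃u ; (there x∈vs) → dom x∈vs }
  ... | no ¬near with D₁ , win₁ , v∈D₁ , keep ← occupy win v
                 with D′ , win′ , J′ , J′⊆D′ , indep′ , vJ⊆J′ , dom ← sweep vs (v ∷ J) win₁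
                   (λ { (here refl) → v∈D₁ ; (there u∈J) → keep (J⊆D u∈J) λ v≃u → ¬near (_ , u∈J , v≃u) })
                   (λ { (here refl) (here refl) → ~-irrefl refl
                      ; (here refl) (there y∈J) v~y → ¬near (_ , y∈J , inj₂ v~y)
                      ; (there x∈J) (here refl) x~v → ¬near (_ , x∈J , inj₂ (~-sym x~v))
                      ; (there x∈J) (there y∈J) → indep x∈J y∈J }) =
    D′ , win′ , J′ , J′⊆D′ , indep′ , (λ u∈J → vJ⊆J′ (there u∈J)) ,
      λ { (here refl) → v , vJ⊆J′ (here refl) , inj₁ refl ; (there x∈vs) → dom x∈vs }

  -- The swept set `J` dominates and is fully guarded. A guard outside `J` could therefore be
  -- removed without uncovering any vertex, against `remove`; so `I` has no vertices beyond `J`.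
  independent-winning : ∀ {D} → Winning D → ∃ λ I → Winning I × Independent I
  independent-winning win
    with I , win′ , J , J⊆I , indep , _ , dom ← sweep (allFin n) [] win (λ ()) (λ ()) =
    I , win′ , λ u∈I v∈I → indep (I⊆J u∈I) (I⊆J v∈I)
    where
    open import Data.List.Membership.DecPropositional (_≟_ {n}) using () renaming (_∈?_ to _∈ₗ?_)
    I⊆J : ∀ {g} → g ∈ I → g Mem.∈ J
    I⊆J {g} g∈I with g ∈ₗ? J
    ... | yes g∈J = g∈J
    ... | no g∉J with y , far ← remove win′ g∈I with u , u∈J , y≃u ← dom (∈-allFin y) =
      contradiction y≃u (far (J⊆I u∈J) λ { refl → g∉J u∈J })

  -- Private neighbours and friends

  module Position (I : Subset n) (I-win : Winning I) (I-indep : Independent I) where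

    Private : Fin n → Fin n → Set
    Private p v = p ∉ I × p ~ v × (∀ h → h ∈ I → h ~ p → h ≡ v)

    private? : ∀ p v → Dec (Private p v)
    private? p v = ¬? (p ∈? I) ×-dec ((p ~? v) ×-dec all? λ h → (h ∈? I) →-dec ((h ~? p) →-dec (h ≟ v)))

    Rich : Fin n → Set
    Rich v = ∃ λ p → Private p v

    rich? : ∀ v → Dec (Rich v)
    rich? v = any? λ p → private? p v

    Friend : Fin n → Fin n → Set
    Friend v y = v ∈ I × v ~ y × (∀ p → Private p v → p ≃ y)

    friend? : ∀ v y → Dec (Friend v y)
    friend? v y = (v ∈? I) ×-dec ((v ~? y) ×-dec all? λ p → private? p v →-dec (p ≃? y))

    ∉⇒≢ : ∀ {y v} → v ∈ I → y ∉ I → v ≢ y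
    ∉⇒≢ v∈I y∉I refl = y∉I v∈I

    -- Once `v` has left for `y`, a private neighbour of `v` has no other old guard beside it, so
    -- the new guard on `y` must cover it.
    respond-friend : ∀ {y} → y ∉ I → ∃ λ v → Friend v y × Winning (move I v y)
    respond-friend {y} y∉I with v , v∈I , v~y , win ← respond I-win y y∉I = v , (v∈I , v~y , near) , win
      where
      near : ∀ p → Private p v → p ≃ y
      near p (p∉I , p~v , only) with u , u∈ , p≃u ← covered win p with ∈-move⁻ u∈ | p≃u
      ... | inj₁ refl        | _         = p≃u
      ... | inj₂ (u∈I , _)   | inj₁ refl = contradiction u∈I p∉I
      ... | inj₂ (u∈I , u≢v) | inj₂ p~u  = contradiction (only u u∈I (~-sym p~u)) u≢v

    bare-friend : ∀ {v y} → v ∈ I → ¬ Rich v → v ~ y → Friend v y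
    bare-friend v∈I bare v~y = v∈I , v~y , λ p priv → contradiction (p , priv) bare

    second-guard : ∀ {y v} → y ∉ I → v ~ y → ¬ Private y v → ∃ λ u → u ∈ I × u ~ y × u ≢ v
    second-guard {y} {v} y∉I v~y ¬priv with any? (λ u → (u ∈? I) ×-dec ((u ~? y) ×-dec ¬? (u ≟ v)))
    ... | yes found = found
    ... | no none = contradiction (y∉I , ~-sym v~y , λ h h∈I h~y →
      decidable-stable (h ≟ v) λ h≢v → none (h , h∈I , h~y , h≢v)) ¬priv

    -- Vertices between two guards

    Within : Fin n → Fin n → Fin n → Set
    Within y g b = ∀ h → h ∈ I → h ~ y → h ≡ g ⊎ h ≡ b

    Pair : Fin n → Fin n → Fin n → Set
    Pair y g b = y ∉ I × g ~ y × b ~ y × Within y g b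

    within? : ∀ y g b → Dec (Within y g b)
    within? y g b = all? λ h → (h ∈? I) →-dec ((h ~? y) →-dec ((h ≟ g) ⊎-dec (h ≟ b)))

    pair? : ∀ y g b → Dec (Pair y g b)
    pair? y g b = ¬? (y ∈? I) ×-dec ((g ~? y) ×-dec ((b ~? y) ×-dec within? y g b))

    pair-sym : ∀ {y g b} → Pair y g b → Pair y b g
    pair-sym (y∉I , g~y , b~y , within) = y∉I , b~y , g~y , λ h h∈I h~y → swap (within h h∈I h~y)

    -- Otherwise the guards on g and b could be replaced by a single guard on w.
    parallel : ∀ {w g b} → g ∈ I → b ∈ I → g ≢ b → ¬ Rich g → ¬ Rich b → g ~ w → b ~ w →
      ∃ λ z → Pair z g b × ¬ z ≃ w
    parallel {w} {g} {b} g∈I b∈I g≢b bare-g bare-b g~w b~w with z , z≄w , far ← merge I-win g∈I b∈I g≢b w =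
      z , (z∉I , g~z , b~z , within) , z≄w
      where
      z∉I : z ∉ I
      z∉I z∈I with z ≟ g | z ≟ b
      ... | yes refl | _        = z≄w (inj₂ g~w)
      ... | no _     | yes refl = z≄w (inj₂ b~w)
      ... | no z≢g   | no z≢b   = far z∈I z≢g z≢b (inj₁ refl)

      within : Within z g b
      within h h∈I h~z with h ≟ g | h ≟ b
      ... | yes h≡g | _       = inj₁ h≡g
      ... | no _    | yes h≡b = inj₂ h≡b
      ... | no h≢g  | no h≢b  = contradiction (inj₂ (~-sym h~z)) (far h∈I h≢g h≢b)

      -- `I` covers `z`, and only `g` and `b` can do so. If one of them did it alone, `z` would be
      -- its private neighbour, but neither has any.
      adjacent : ∀ {x y} → (∀ h → h ∈ I → h ~ z → h ≡ x ⊎ h ≡ y) → ¬ Rich y → x ~ z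
      adjacent {x} {y} within bare with x ~? z | covered I-win z
      ... | yes x~z | _                    = x~z
      ... | no _    | u , u∈I , inj₁ refl = contradiction u∈I z∉I
      ... | no x≁z  | u , u∈I , inj₂ z~u  = contradiction (z , z∉I , z~y , λ h h∈I h~z → only-y h∈I h~z) bare
        where
        only-y : ∀ {h} → h ∈ I → h ~ z → h ≡ y
        only-y h∈I h~z with within _ h∈I h~z
        ... | inj₁ refl = contradiction h~z x≁z
        ... | inj₂ h≡y  = h≡y
        z~y : z ~ y
        z~y = subst (z ~_) (only-y u∈I (~-sym z~u)) z~u

      g~z : g ~ z
      g~z = adjacent within bare-b
      b~z : b ~ z
      b~z = adjacent (λ h h∈I h~z → swap (within h h∈I h~z)) bare-g

    -- Attacks on e, y and z in this order would need three guards from {g, b}.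
    crowd : ∀ {e y z g b} → e ∉ I → y ∉ I → z ∉ I → ¬ e ≃ y → ¬ e ≃ z → ¬ y ≃ z →
      (∀ s → Friend s e → s ≡ g ⊎ s ≡ b) → Within y g b → Within z g b → ⊥
    crowd {e} {y} {z} {g} {b} e∉I y∉I z∉I e≄y e≄z y≄z friends within-y within-z
      with s , s-friend , win₁ ← respond-friend e∉I
      with t , t∈ , t~y , win₂ ← respond win₁ y (λ y∈ → [ (λ { refl → e≄y (inj₁ refl) }) , (λ (y∈I , _) → y∉I y∈I) ]′ (∈-move⁻ y∈))
      with ∈-move⁻ t∈
    ... | inj₁ refl = e≄y (inj₂ t~y)
    ... | inj₂ (t∈I , t≢s)
      with u , u∈ , u~z , _ ← respond win₂ z (λ z∈ → [ (λ { refl → y≄z (inj₁ refl) }) ,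
             (λ (z∈₁ , _) → [ (λ { refl → e≄z (inj₁ refl) }) , (λ (z∈I , _) → z∉I z∈I) ]′ (∈-move⁻ z∈₁)) ]′ (∈-move⁻ z∈))
      with ∈-move⁻ u∈
    ... | inj₁ refl = y≄z (inj₂ u~z)
    ... | inj₂ (u∈₁ , u≢t) with ∈-move⁻ u∈₁
    ... | inj₁ refl = e≄z (inj₂ u~z)
    ... | inj₂ (u∈I , u≢s) with friends s s-friend | within-y t t∈I t~y | within-z u u∈I u~z
    ... | inj₁ refl | inj₁ refl | _         = t≢s refl
    ... | inj₁ refl | inj₂ refl | inj₁ refl = u≢s refl
    ... | inj₁ refl | inj₂ refl | inj₂ refl = u≢t refl
    ... | inj₂ refl | inj₂ refl | _         = t≢s refl
    ... | inj₂ refl | inj₁ refl | inj₁ refl = u≢t refl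
    ... | inj₂ refl | inj₁ refl | inj₂ refl = u≢s refl

    -- Vertices whose friends have no private neighbours

    Free : Fin n → Set
    Free y = y ∉ I × (∀ v → Friend v y → ¬ Rich v)

    Sole : Fin n → Fin n → Set
    Sole y v = Free y × Friend v y × (∀ u → Friend u y → u ≡ v)

    -- Let `h` be a third guard next to `y`. Two uses of `parallel` give `z` and `z₂` between `g`
    -- and `b` alone. A rich `h` is no friend of the free vertex `y`, so `crowd` applies to `y`, `z`
    -- and `z₂`. For a bare `h`, `parallel` on `g` and `h` yields a fourth neighbour of `g`.
    free-within : ∀ {y g b} → Free y → g ∈ I → b ∈ I → g ≢ b → ¬ Rich g → ¬ Rich b → g ~ y → b ~ y → Within y g b
    free-within {y} {g} {b} (y∉I , poor) g∈I b∈I g≢b bare-g bare-b g~y b~y h h∈I h~y with h ≟ g | h ≟ b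
    ... | yes h≡g | _       = inj₁ h≡g
    ... | no _    | yes h≡b = inj₂ h≡b
    ... | no h≢g  | no h≢b
      with z  , (z∉I  , g~z  , b~z  , within-z)  , z≄y  ← parallel g∈I b∈I g≢b bare-g bare-b g~y b~y
      with z₂ , (z₂∉I , g~z₂ , b~z₂ , within-z₂) , z₂≄z ← parallel g∈I b∈I g≢b bare-g bare-b g~z b~z
      with rich? h
    ... | yes rich-h = ⊥-elim (crowd y∉I z∉I z₂∉I (z≄y ∘ ≃-sym) y≄z₂ (z₂≄z ∘ ≃-sym) friends within-z within-z₂)
      where
      neighbours-y : ∀ {x} → y ~ x → x ≡ g ⊎ x ≡ b ⊎ x ≡ h
      neighbours-y = three-neighbours (~-sym g~y) (~-sym b~y) (~-sym h~y) g≢b (≢-sym h≢g) (≢-sym h≢b)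

      y≄z₂ : ¬ y ≃ z₂
      y≄z₂ (inj₁ refl) = [ h≢g , h≢b ]′ (within-z₂ h h∈I h~y)
      y≄z₂ (inj₂ y~z₂) with neighbours-y y~z₂
      ... | inj₁ refl        = z₂∉I g∈I
      ... | inj₂ (inj₁ refl) = z₂∉I b∈I
      ... | inj₂ (inj₂ refl) = z₂∉I h∈I

      friends : ∀ s → Friend s y → s ≡ g ⊎ s ≡ b
      friends s f@(_ , s~y , _) with neighbours-y (~-sym s~y)
      ... | inj₁ s≡g         = inj₁ s≡g
      ... | inj₂ (inj₁ s≡b)  = inj₂ s≡b
      ... | inj₂ (inj₂ refl) = contradiction rich-h (poor h f)
    ... | no bare-h
      with z₃ , (_ , g~z₃ , h~z₃ , _) , z₃≄y ← parallel g∈I h∈I (≢-sym h≢g) bare-g bare-h g~y h~y =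
      ⊥-elim (four-neighbours g~y g~z g~z₂ g~z₃ (z≄y ∘ inj₁ ∘ sym) (λ { refl → apart within-z₂ h~y }) (z₃≄y ∘ inj₁ ∘ sym)
        (z₂≄z ∘ inj₁ ∘ sym) (λ { refl → apart within-z h~z₃ }) (λ { refl → apart within-z₂ h~z₃ }))
      where
      apart : ∀ {x} → Within x g b → h ~ x → ⊥
      apart within h~x = [ h≢g , h≢b ]′ (within h h∈I h~x)

    -- Vertices with the same sole friend are adjacent

    -- After an attack on w the guard on a is gone, so the attack on w₂ draws the
    -- guard on some c that is not a friend of w₂.
    Dodge : (a w w₂ c p : Fin n) → Set
    Dodge a w w₂ c p = c ∈ I × c ≢ a × c ~ w₂ × Private p c × p ~ w × ¬ p ≃ w₂ × Winning (move (move I a w) c w₂)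

    -- As `c` is not a friend of `w₂`, it has a private neighbour `p` that `w₂` does not cover.
    -- After `c` has left, only the new guard on `w` can cover `p`.
    dodge : ∀ {a w w₂} → Sole w a → Sole w₂ a → ¬ w ≃ w₂ → ∃ λ c → ∃ λ p → Dodge a w w₂ c p
    dodge {a} {w} {w₂} ((w∉I , _) , (a∈I , a~w , _) , only) ((w₂∉I , _) , _ , only₂) w≄w₂
      with s , f , win₁ ← respond-friend w∉I
      with refl ← only s f
      with c , c∈ , c~w₂ , win₂ ← respond win₁ w₂ (λ w₂∈ → [ (λ { refl → w≄w₂ (inj₁ refl) }) , (λ (w₂∈I , _) → w₂∉I w₂∈I) ]′ (∈-move⁻ w₂∈))
      with ∈-move⁻ c∈
    ... | inj₁ refl = contradiction (inj₂ c~w₂) w≄w₂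
    ... | inj₂ (c∈I , c≢a) with any? (λ p → private? p c ×-dec ¬? (p ≃? w₂))
    ... | no none = contradiction
      (only₂ c (c∈I , c~w₂ , λ p priv → decidable-stable (p ≃? w₂) λ p≄w₂ → none (p , priv , p≄w₂))) c≢a
    ... | yes (p , priv@(p∉I , p~c , p-only) , p≄w₂) = c , p , c∈I , c≢a , c~w₂ , priv , p~w , p≄w₂ , win₂
      where
      p~w : p ~ w
      p~w with u , u∈ , p≃u ← covered win₂ p with ∈-move⁻ u∈
      ... | inj₁ refl = contradiction p≃u p≄w₂
      ... | inj₂ (u∈₁ , u≢c) with ∈-move⁻ u∈₁ | p≃u
      ... | inj₁ refl      | inj₁ refl = contradiction (sym (p-only a a∈I a~w)) c≢a
      ... | inj₁ refl      | inj₂ p~w  = p~w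
      ... | inj₂ (u∈I , _) | inj₁ refl = contradiction u∈I p∉I
      ... | inj₂ (u∈I , _) | inj₂ p~u  = contradiction (p-only u u∈I (~-sym p~u)) u≢c

    -- The two orders of attack together determine the neighbourhoods of `w` and `w₂`. Further play
    -- forces `p ~ p₂`, which fills the neighbourhoods of `p` and `p₂` as well; then the attacks
    -- `w`, `w₂`, `y`, `a` lead to positions that cannot be held.
    dodge-absurd : ∀ {a w w₂ c p c₂ p₂} → Sole w a → Sole w₂ a → ¬ w ≃ w₂ →
      Dodge a w w₂ c p → Dodge a w₂ w c₂ p₂ → ⊥
    dodge-absurd {a} {w} {w₂} {c} {p} {c₂} {p₂} ((w∉I , _) , (a∈I , a~w , _) , _) ((w₂∉I , _) , (_ , a~w₂ , _) , _) w≄w₂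
      (c∈I  , c≢a  , c~w₂ , (p∉I  , p~c   , p-only)  , p~w   , p≄w₂ , win₂)
      (c₂∈I , c₂≢a , c₂~w , (p₂∉I , p₂~c₂ , p₂-only) , p₂~w₂ , p₂≄w , _) = attack-y
      where
      p≢p₂ : p ≢ p₂
      p≢p₂ refl = p≄w₂ (inj₂ p₂~w₂)

      c≢c₂ : c ≢ c₂
      c≢c₂ refl = four-neighbours (~-sym p~c) (~-sym p₂~c₂) c₂~w c~w₂
        p≢p₂ (~⇒≢ p~w) (p≄w₂ ∘ inj₁) (p₂≄w ∘ inj₁) (~⇒≢ p₂~w₂) (w≄w₂ ∘ inj₁)

      N-w : ∀ {x} → w ~ x → x ≡ a ⊎ x ≡ c₂ ⊎ x ≡ p
      N-w = three-neighbours (~-sym a~w) (~-sym c₂~w) (~-sym p~w) (≢-sym c₂≢a) (∉⇒≢ a∈I p∉I) (∉⇒≢ c₂∈I p∉I)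

      N-w₂ : ∀ {x} → w₂ ~ x → x ≡ a ⊎ x ≡ c ⊎ x ≡ p₂
      N-w₂ = three-neighbours (~-sym a~w₂) (~-sym c~w₂) (~-sym p₂~w₂) (≢-sym c≢a) (∉⇒≢ a∈I p₂∉I) (∉⇒≢ c∈I p₂∉I)

      c≁w : ¬ c ~ w
      c≁w c~w with N-w (~-sym c~w)
      ... | inj₁ c≡a         = c≢a c≡a
      ... | inj₂ (inj₁ c≡c₂) = c≢c₂ c≡c₂
      ... | inj₂ (inj₂ refl) = p∉I c∈I

      -- Attack `p`, which only `c` can answer, and then `w`. If `a` answers, `w₂` is uncovered; if
      -- the guard on `p` answers, `c` is uncovered; if `c₂` answers, only the guard on `p` can
      -- cover `p₂`.
      p~p₂ : p ~ p₂
      p~p₂ with s , s∈I , s~p , win₁ ← respond I-win p p∉I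
           with refl ← p-only s s∈I s~p
           with t , t∈ , t~w , win′ ← respond win₁ w (λ w∈ → [ (λ { refl → ~-irrefl refl p~w }) , (λ (w∈I , _) → w∉I w∈I) ]′ (∈-move⁻ w∈))
           with N-w (~-sym t~w)
      p~p₂ | inj₁ refl with u , u∈ , w₂≃u ← covered win′ w₂ with ∈-move⁻ u∈
      ... | inj₁ refl = contradiction (≃-sym w₂≃u) w≄w₂
      ... | inj₂ (u∈₁ , u≢a) with ∈-move⁻ u∈₁ | w₂≃u
      ... | inj₁ refl        | _         = contradiction (≃-sym w₂≃u) p≄w₂
      ... | inj₂ (u∈I , _)   | inj₁ refl = contradiction u∈I w₂∉I
      ... | inj₂ (u∈I , u≢c) | inj₂ w₂~u with N-w₂ w₂~u
      ... | inj₁ u≡a         = contradiction u≡a u≢a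
      ... | inj₂ (inj₁ u≡c)  = contradiction u≡c u≢c
      ... | inj₂ (inj₂ refl) = contradiction u∈I p₂∉I
      p~p₂ | inj₂ (inj₁ refl) with u , u∈ , p₂≃u ← covered win′ p₂ with ∈-move⁻ u∈
      ... | inj₁ refl = contradiction p₂≃u p₂≄w
      ... | inj₂ (u∈₁ , u≢c₂) with ∈-move⁻ u∈₁ | p₂≃u
      ... | inj₁ refl      | inj₁ p₂≡p = contradiction (sym p₂≡p) p≢p₂
      ... | inj₁ refl      | inj₂ p₂~p = ~-sym p₂~p
      ... | inj₂ (u∈I , _) | inj₁ refl = contradiction u∈I p₂∉I
      ... | inj₂ (u∈I , _) | inj₂ p₂~u = contradiction (p₂-only u u∈I (~-sym p₂~u)) u≢c₂
      p~p₂ | inj₂ (inj₂ refl) with u , u∈ , c≃u ← covered win′ c with ∈-move⁻ u∈ | c≃u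
      ... | inj₁ refl | inj₁ refl = contradiction c∈I w∉I
      ... | inj₁ refl | inj₂ c~w  = contradiction c~w c≁w
      ... | inj₂ (u∈₁ , u≢p) | _ with ∈-move⁻ u∈₁ | c≃u
      ... | inj₁ u≡p         | _         = contradiction u≡p u≢p
      ... | inj₂ (u∈I , u≢c) | inj₁ c≡u  = contradiction (sym c≡u) u≢c
      ... | inj₂ (u∈I , u≢c) | inj₂ c~u  = contradiction c~u (I-indep c∈I u∈I)

      N-p : ∀ {x} → p ~ x → x ≡ c ⊎ x ≡ w ⊎ x ≡ p₂
      N-p = three-neighbours p~c p~w p~p₂ (∉⇒≢ c∈I w∉I) (∉⇒≢ c∈I p₂∉I) (p₂≄w ∘ inj₁ ∘ sym)

      N-p₂ : ∀ {x} → p₂ ~ x → x ≡ c₂ ⊎ x ≡ w₂ ⊎ x ≡ p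
      N-p₂ = three-neighbours p₂~c₂ p₂~w₂ (~-sym p~p₂) (∉⇒≢ c₂∈I w₂∉I) (∉⇒≢ c₂∈I p∉I) (p≄w₂ ∘ inj₁ ∘ sym)

      D₂ : Subset n
      D₂ = move (move I a w) c w₂

      w∈D₂ : w ∈ D₂
      w∈D₂ = ∈-move-old ∈-move-new (≢-sym (∉⇒≢ c∈I w∉I))

      c₂∈D₂ : c₂ ∈ D₂
      c₂∈D₂ = ∈-move-old (∈-move-old c₂∈I c₂≢a) (≢-sym c≢c₂)

      -- With p ~ p₂, a vertex covered by the guard on c₂ alone lies outside the
      -- configuration, so attacking it draws that guard away.
      attack-y : ⊥
      attack-y with y , far ← remove win₂ c₂∈D₂ = finish (λ y≃w → far w∈D₂ (≢-sym (∉⇒≢ c₂∈I w∉I)) y≃w)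
                                                         (far ∈-move-new (≢-sym (∉⇒≢ c₂∈I w₂∉I))) far
        where
        finish : ∀ {y} → ¬ y ≃ w → ¬ y ≃ w₂ → (∀ {u} → u ∈ D₂ → u ≢ c₂ → ¬ y ≃ u) → ⊥
        finish {y} y≄w y≄w₂ far
          with s , s∈ , s~y , win₃ ← respond win₂ y (λ y∈ → far y∈ (λ { refl → y≄w (inj₂ c₂~w) }) (inj₁ refl))
          with s ≟ c₂
        ... | no s≢c₂ = far s∈ s≢c₂ (inj₂ (~-sym s~y))
        ... | yes refl = attack-a
          where
          D₃ : Subset n
          D₃ = move D₂ c₂ y

          D₃⁻ : ∀ {u} → u ∈ D₃ → u ≡ y ⊎ u ≡ w₂ ⊎ u ≡ w ⊎ (u ∈ I × u ≢ a × u ≢ c × u ≢ c₂)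
          D₃⁻ u∈ with ∈-move⁻ u∈
          ... | inj₁ u≡y = inj₁ u≡y
          ... | inj₂ (u∈₂ , u≢c₂) with ∈-move⁻ u∈₂
          ... | inj₁ u≡w₂ = inj₂ (inj₁ u≡w₂)
          ... | inj₂ (u∈₁ , u≢c) with ∈-move⁻ u∈₁
          ... | inj₁ u≡w = inj₂ (inj₂ (inj₁ u≡w))
          ... | inj₂ (u∈I , u≢a) = inj₂ (inj₂ (inj₂ (u∈I , u≢a , u≢c , u≢c₂)))

          -- In `D₃` the vertex `p`, with neighbours `c`, `w` and `p₂`, is covered from `w` alone,
          -- since `y` is near neither `w` nor `w₂`. Symmetrically `p₂` is covered from `w₂` alone.
          -- So neither of these two guards can go to `a`.
          p-uncovered : ∀ {u} → u ≡ y ⊎ u ≡ w₂ ⊎ (u ∈ I × u ≢ c) → ¬ p ≃ u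
          p-uncovered (inj₁ refl) (inj₁ refl) = y≄w (inj₂ p~w)
          p-uncovered (inj₁ refl) (inj₂ p~y) with N-p p~y
          ... | inj₁ refl        = y≄w₂ (inj₂ c~w₂)
          ... | inj₂ (inj₁ refl) = y≄w (inj₁ refl)
          ... | inj₂ (inj₂ refl) = y≄w₂ (inj₂ p₂~w₂)
          p-uncovered (inj₂ (inj₁ refl)) p≃w₂ = p≄w₂ p≃w₂
          p-uncovered (inj₂ (inj₂ (u∈I , _)))   (inj₁ refl) = p∉I u∈I
          p-uncovered (inj₂ (inj₂ (u∈I , u≢c))) (inj₂ p~u)  = u≢c (p-only _ u∈I (~-sym p~u))

          p₂-uncovered : ∀ {u} → u ≡ y ⊎ u ≡ w ⊎ (u ∈ I × u ≢ c₂) → ¬ p₂ ≃ u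
          p₂-uncovered (inj₁ refl) (inj₁ refl) = y≄w₂ (inj₂ p₂~w₂)
          p₂-uncovered (inj₁ refl) (inj₂ p₂~y) with N-p₂ p₂~y
          ... | inj₁ refl        = y≄w (inj₂ c₂~w)
          ... | inj₂ (inj₁ refl) = y≄w₂ (inj₁ refl)
          ... | inj₂ (inj₂ refl) = y≄w (inj₂ p~w)
          p₂-uncovered (inj₂ (inj₁ refl)) p₂≃w = p₂≄w p₂≃w
          p₂-uncovered (inj₂ (inj₂ (u∈I , _)))    (inj₁ refl) = p₂∉I u∈I
          p₂-uncovered (inj₂ (inj₂ (u∈I , u≢c₂))) (inj₂ p₂~u) = u≢c₂ (p₂-only _ u∈I (~-sym p₂~u))

          a∉D₃ : a ∉ D₃
          a∉D₃ a∈ with D₃⁻ a∈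
          ... | inj₁ refl                              = y≄w (inj₂ a~w)
          ... | inj₂ (inj₁ refl)                       = w₂∉I a∈I
          ... | inj₂ (inj₂ (inj₁ refl))                = w∉I a∈I
          ... | inj₂ (inj₂ (inj₂ (_ , a≢a , _)))       = a≢a refl

          w-pinned : ∀ {r} → r ∈ I → r ≢ c → ∀ {D} → (∀ {u} → u ∈ D → u ≢ w → u ≡ y ⊎ u ≡ w₂ ⊎ (u ∈ I × u ≢ c)) →
            ¬ Winning (move D w r)
          w-pinned r∈I r≢c guards win with u , u∈ , p≃u ← covered win p with ∈-move⁻ u∈
          ... | inj₁ refl = p-uncovered (inj₂ (inj₂ (r∈I , r≢c))) p≃u
          ... | inj₂ (u∈D , u≢w) = p-uncovered (guards u∈D u≢w) p≃u

          D₃-guards : ∀ {u} → u ∈ D₃ → u ≢ w → u ≡ y ⊎ u ≡ w₂ ⊎ (u ∈ I × u ≢ c)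
          D₃-guards u∈ u≢w with D₃⁻ u∈
          ... | inj₁ u≡y                               = inj₁ u≡y
          ... | inj₂ (inj₁ u≡w₂)                       = inj₂ (inj₁ u≡w₂)
          ... | inj₂ (inj₂ (inj₁ u≡w))                 = contradiction u≡w u≢w
          ... | inj₂ (inj₂ (inj₂ (u∈I , _ , u≢c , _))) = inj₂ (inj₂ (u∈I , u≢c))

          w₂-pinned : ¬ Winning (move D₃ w₂ a)
          w₂-pinned win with u , u∈ , p₂≃u ← covered win p₂ with ∈-move⁻ u∈
          ... | inj₁ refl = p₂-uncovered (inj₂ (inj₂ (a∈I , ≢-sym c₂≢a))) p₂≃u
          ... | inj₂ (u∈₃ , u≢w₂) with D₃⁻ u∈₃
          ... | inj₁ u≡y                                = p₂-uncovered (inj₁ u≡y) p₂≃u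
          ... | inj₂ (inj₁ u≡w₂)                        = u≢w₂ u≡w₂
          ... | inj₂ (inj₂ (inj₁ u≡w))                  = p₂-uncovered (inj₂ (inj₁ u≡w)) p₂≃u
          ... | inj₂ (inj₂ (inj₂ (u∈I , _ , _ , u≢c₂))) = p₂-uncovered (inj₂ (inj₂ (u∈I , u≢c₂))) p₂≃u

          c₂∉D₄ : c₂ ∉ move D₃ y a
          c₂∉D₄ c₂∈ with ∈-move⁻ c₂∈
          ... | inj₁ c₂≡a = c₂≢a c₂≡a
          ... | inj₂ (c₂∈₃ , _) with D₃⁻ c₂∈₃
          ... | inj₁ refl                                  = y≄w (inj₂ c₂~w)
          ... | inj₂ (inj₁ refl)                           = w₂∉I c₂∈I
          ... | inj₂ (inj₂ (inj₁ refl))                    = w∉I c₂∈I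
          ... | inj₂ (inj₂ (inj₂ (_ , _ , _ , c₂≢c₂)))     = c₂≢c₂ refl

          -- If the guard on `y` goes to `a`, attack `c₂`. By independence only `w` or `w₂` could
          -- answer, but `w` must stay for `p`, and `w₂` is not adjacent to `c₂`.
          y-pinned : ¬ Winning (move D₃ y a)
          y-pinned win with t , t∈ , t~c₂ , win₅ ← respond win c₂ c₂∉D₄ with ∈-move⁻ t∈
          ... | inj₁ refl = I-indep a∈I c₂∈I t~c₂
          ... | inj₂ (t∈₃ , t≢y) with D₃⁻ t∈₃
          ... | inj₁ t≡y = t≢y t≡y
          ... | inj₂ (inj₂ (inj₂ (t∈I , _))) = I-indep t∈I c₂∈I t~c₂
          ... | inj₂ (inj₂ (inj₁ refl)) = w-pinned c₂∈I (≢-sym c≢c₂) guards win₅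
            where
            guards : ∀ {u} → u ∈ move D₃ y a → u ≢ w → u ≡ y ⊎ u ≡ w₂ ⊎ (u ∈ I × u ≢ c)
            guards u∈ u≢w with ∈-move⁻ u∈
            ... | inj₁ refl      = inj₂ (inj₂ (a∈I , ≢-sym c≢a))
            ... | inj₂ (u∈₃ , _) = D₃-guards u∈₃ u≢w
          ... | inj₂ (inj₁ refl) with N-w₂ t~c₂
          ... | inj₁ c₂≡a         = c₂≢a c₂≡a
          ... | inj₂ (inj₁ c₂≡c)  = c≢c₂ (sym c₂≡c)
          ... | inj₂ (inj₂ c₂≡p₂) = ∉⇒≢ c₂∈I p₂∉I c₂≡p₂

          attack-a : ⊥
          attack-a with s , s∈ , s~a , win₄ ← respond win₃ a a∉D₃ with D₃⁻ s∈
          ... | inj₁ refl                    = y-pinned win₄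
          ... | inj₂ (inj₁ refl)             = w₂-pinned win₄
          ... | inj₂ (inj₂ (inj₁ refl))      = w-pinned a∈I (≢-sym c≢a) D₃-guards win₄
          ... | inj₂ (inj₂ (inj₂ (s∈I , _))) = I-indep s∈I a∈I s~a

    sole-adjacent : ∀ {a w w₂} → Sole w a → Sole w₂ a → w ≃ w₂
    sole-adjacent {a} {w} {w₂} sole sole₂ with w ≃? w₂
    ... | yes w≃w₂ = w≃w₂
    ... | no w≄w₂ with c , p , d ← dodge sole sole₂ w≄w₂ | c₂ , p₂ , d₂ ← dodge sole₂ sole (w≄w₂ ∘ ≃-sym) =
      ⊥-elim (dodge-absurd sole sole₂ w≄w₂ d d₂)

    -- Conflicts at a guard with private neighbours

    record Twins (v w w₂ : Fin n) : Set where
      field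
        u x  : Fin n
        u∈I  : u ∈ I
        bare : ¬ Rich u
        u~w  : u ~ w
        u~w₂ : u ~ w₂
        priv : Private x v
        N-u  : ∀ {t} → u ~ t → t ≡ w ⊎ t ≡ w₂
        N-v  : ∀ {t} → v ~ t → t ≡ x ⊎ t ≡ w ⊎ t ≡ w₂
        N-w  : ∀ {t} → w ~ t → t ≡ v ⊎ t ≡ x ⊎ t ≡ u
        N-w₂ : ∀ {t} → w₂ ~ t → t ≡ v ⊎ t ≡ x ⊎ t ≡ u

    friend⇒∉ : ∀ {v y} → Friend v y → y ∉ I
    friend⇒∉ (v∈I , v~y , _) y∈I = I-indep v∈I y∈I v~y

    twins : ∀ {v w w₂} → Rich v → Friend v w → Friend v w₂ → ¬ w ≃ w₂ → Twins v w w₂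
    twins {v} {w} {w₂} (x , priv-x@(x∉I , x~v , _)) f@(v∈I , v~w , near) f₂@(_ , v~w₂ , near₂) w≄w₂
      with friend⇒∉ f | friend⇒∉ f₂
    ... | w∉I | w₂∉I
      with u  , u∈I  , u~w   , u≢v  ← second-guard w∉I v~w (λ priv → w≄w₂ (near₂ w priv))
         | u₂ , u₂∈I , u₂~w₂ , u₂≢v ← second-guard w₂∉I v~w₂ (λ priv → w≄w₂ (≃-sym (near w₂ priv)))
      = shared
      where
      x~w : x ~ w
      x~w with near x priv-x
      ... | inj₁ refl = contradiction (near₂ x priv-x) w≄w₂
      ... | inj₂ x~w  = x~w

      x~w₂ : x ~ w₂
      x~w₂ with near₂ x priv-x
      ... | inj₁ refl = contradiction (≃-sym (near x priv-x)) w≄w₂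
      ... | inj₂ x~w₂ = x~w₂

      N-v : ∀ {t} → v ~ t → t ≡ x ⊎ t ≡ w ⊎ t ≡ w₂
      N-v = three-neighbours (~-sym x~v) v~w v~w₂ (~⇒≢ x~w) (~⇒≢ x~w₂) (w≄w₂ ∘ inj₁)

      N-x : ∀ {t} → x ~ t → t ≡ v ⊎ t ≡ w ⊎ t ≡ w₂
      N-x = three-neighbours x~v x~w x~w₂ (∉⇒≢ v∈I w∉I) (∉⇒≢ v∈I w₂∉I) (w≄w₂ ∘ inj₁)

      N-w : ∀ {t} → w ~ t → t ≡ v ⊎ t ≡ x ⊎ t ≡ u
      N-w = three-neighbours (~-sym v~w) (~-sym x~w) (~-sym u~w) (∉⇒≢ v∈I x∉I) (≢-sym u≢v) (≢-sym (∉⇒≢ u∈I x∉I))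

      N-w₂ : ∀ {t} → w₂ ~ t → t ≡ v ⊎ t ≡ x ⊎ t ≡ u₂
      N-w₂ = three-neighbours (~-sym v~w₂) (~-sym x~w₂) (~-sym u₂~w₂) (∉⇒≢ v∈I x∉I) (≢-sym u₂≢v) (≢-sym (∉⇒≢ u₂∈I x∉I))

      u-pinned : u ≢ u₂ → ¬ Winning (move I u w)
      u-pinned u≢u₂ win with y , far ← remove win (∈-move-old {D = I} v∈I (≢-sym u≢v)) with g , g∈ , y≃g ← covered win y with g ≟ v
      ... | no g≢v = far g∈ g≢v y≃g
      ... | yes refl = near-v y≃g
        where
        w-far : ¬ y ≃ w
        w-far = far ∈-move-new (≢-sym (∉⇒≢ v∈I w∉I))
        near-v : ¬ y ≃ v
        near-v (inj₁ refl) = w-far (inj₂ v~w)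
        near-v (inj₂ y~v) with N-v (~-sym y~v)
        ... | inj₁ refl        = w-far (inj₂ x~w)
        ... | inj₂ (inj₁ refl) = w-far (inj₁ refl)
        ... | inj₂ (inj₂ refl) = far (∈-move-old u₂∈I (≢-sym u≢u₂)) u₂≢v (inj₂ (~-sym u₂~w₂))

      v-pinned : u ≢ u₂ → ¬ Winning (move I v w)
      v-pinned u≢u₂ win
        with t , t∈ , t~w₂ , win₂ ← respond win w₂ (λ w₂∈ → [ (λ { refl → w≄w₂ (inj₁ refl) }) , (λ (w₂∈I , _) → w₂∉I w₂∈I) ]′ (∈-move⁻ w₂∈))
        with ∈-move⁻ t∈
      ... | inj₁ refl = w≄w₂ (inj₂ t~w₂)
      ... | inj₂ (t∈I , t≢v) with N-w₂ (~-sym t~w₂)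
      ... | inj₁ t≡v         = t≢v t≡v
      ... | inj₂ (inj₁ refl) = x∉I t∈I
      ... | inj₂ (inj₂ refl)
        with y , far ← remove win₂ (∈-move-old {D = move I v w} ∈-move-new (≢-sym (∉⇒≢ u₂∈I w∉I)))
        with g , g∈ , y≃g ← covered win₂ y with g ≟ w
      ... | no g≢w = far g∈ g≢w y≃g
      ... | yes refl = near-w y≃g
        where
        u-far : ¬ y ≃ u
        u-far = far (∈-move-old (∈-move-old u∈I u≢v) u≢u₂) (∉⇒≢ u∈I w∉I)
        w₂-far : ¬ y ≃ w₂
        w₂-far = far ∈-move-new (w≄w₂ ∘ inj₁ ∘ sym)
        near-w : ¬ y ≃ w
        near-w (inj₁ refl) = u-far (inj₂ (~-sym u~w))
        near-w (inj₂ y~w) with N-w (~-sym y~w)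
        ... | inj₁ refl        = w₂-far (inj₂ v~w₂)
        ... | inj₂ (inj₁ refl) = w₂-far (inj₂ x~w₂)
        ... | inj₂ (inj₂ refl) = u-far (inj₁ refl)

      u≡u₂ : u ≡ u₂
      u≡u₂ with u ≟ u₂
      ... | yes eq = eq
      ... | no u≢u₂ with s , s∈I , s~w , win ← respond I-win w w∉I with N-w (~-sym s~w)
      ... | inj₁ refl        = contradiction win (v-pinned u≢u₂)
      ... | inj₂ (inj₁ refl) = contradiction s∈I x∉I
      ... | inj₂ (inj₂ refl) = contradiction win (u-pinned u≢u₂)

      -- With guards on w, w₂ and a third neighbour t of u, those on w and w₂
      -- could be replaced by a single guard on v.
      N-u : ∀ {t} → u ~ t → t ≡ w ⊎ t ≡ w₂
      N-u {t} u~t with t ≟ w | t ≟ w₂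
      ... | yes t≡w | _        = inj₁ t≡w
      ... | no _    | yes t≡w₂ = inj₂ t≡w₂
      ... | no t≢w  | no t≢w₂  = ⊥-elim third
        where
        t≢v : t ≢ v
        t≢v refl = I-indep u∈I v∈I u~t
        t≢x : t ≢ x
        t≢x refl with N-x (~-sym u~t)
        ... | inj₁ u≡v         = u≢v u≡v
        ... | inj₂ (inj₁ refl) = w∉I u∈I
        ... | inj₂ (inj₂ refl) = w₂∉I u∈I
        t≢u : t ≢ u
        t≢u = ≢-sym (~⇒≢ u~t)
        t≄w : ¬ t ≃ w
        t≄w (inj₁ t≡w) = t≢w t≡w
        t≄w (inj₂ t~w) = [ t≢v , [ t≢x , t≢u ]′ ]′ (N-w (~-sym t~w))
        t≄w₂ : ¬ t ≃ w₂
        t≄w₂ (inj₁ t≡w₂) = t≢w₂ t≡w₂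
        t≄w₂ (inj₂ t~w₂) = [ t≢v , [ t≢x , (λ { refl → t≢u (sym u≡u₂) }) ]′ ]′ (N-w₂ (~-sym t~w₂))
        third : ⊥
        third
          with D₁ , win₁ , w∈₁ , keep₁ ← occupy I-win w
          with D₂ , win₂ , w₂∈₂ , keep₂ ← occupy win₁ w₂
          with D₃ , win₃ , t∈₃ , keep₃ ← occupy win₂ t
          with y , y≄v , far ← merge win₃ (keep₃ (keep₂ w∈₁ (w≄w₂ ∘ ≃-sym)) t≄w) (keep₃ w₂∈₂ t≄w₂) (w≄w₂ ∘ inj₁) v
          with g , g∈ , y≃g ← covered win₃ y
          with g ≟ w | g ≟ w₂
        ... | no g≢w | no g≢w₂ = far g∈ g≢w g≢w₂ y≃g
        ... | yes refl | _ = near-w y≃g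
          where
          near-w : ¬ y ≃ w
          near-w (inj₁ refl) = y≄v (inj₂ (~-sym v~w))
          near-w (inj₂ y~w) with N-w (~-sym y~w)
          ... | inj₁ refl        = y≄v (inj₁ refl)
          ... | inj₂ (inj₁ refl) = y≄v (inj₂ x~v)
          ... | inj₂ (inj₂ refl) = far t∈₃ t≢w t≢w₂ (inj₂ u~t)
        ... | no _ | yes refl = near-w₂ y≃g
          where
          near-w₂ : ¬ y ≃ w₂
          near-w₂ (inj₁ refl) = y≄v (inj₂ (~-sym v~w₂))
          near-w₂ (inj₂ y~w₂) with N-w₂ (~-sym y~w₂)
          ... | inj₁ refl        = y≄v (inj₁ refl)
          ... | inj₂ (inj₁ refl) = y≄v (inj₂ x~v)
          ... | inj₂ (inj₂ refl) = far t∈₃ t≢w t≢w₂ (inj₂ (subst (_~ t) u≡u₂ u~t))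

      bare-u : ¬ Rich u
      bare-u (q , _ , q~u , only) with N-u (~-sym q~u)
      ... | inj₁ refl = u≢v (sym (only v v∈I v~w))
      ... | inj₂ refl = u≢v (sym (only v v∈I v~w₂))

      shared : Twins v w w₂
      shared = record
        { u = u ; x = x ; u∈I = u∈I ; bare = bare-u ; u~w = u~w ; u~w₂ = subst (_~ w₂) (sym u≡u₂) u₂~w₂
        ; priv = priv-x ; N-u = N-u ; N-v = N-v ; N-w = N-w
        ; N-w₂ = subst (λ b → ∀ {t} → w₂ ~ t → t ≡ v ⊎ t ≡ x ⊎ t ≡ b) (sym u≡u₂) N-w₂ }

    -- Claims on friends

    Twosome : Fin n → Fin n → Fin n → Set
    Twosome y v b = v ∈ I × b ∈ I × ¬ Rich v × ¬ Rich b × v ≢ b × Pair y v b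

    twosome-sym : ∀ {y v b} → Twosome y v b → Twosome y b v
    twosome-sym (v∈I , b∈I , bare-v , bare-b , v≢b , pair) = b∈I , v∈I , bare-b , bare-v , ≢-sym v≢b , pair-sym pair

    LeastPair : Fin n → Fin n → Fin n → Set
    LeastPair m v b = Pair m v b × (∀ i → i < m → ¬ Pair i v b)

    Lead : Fin n → Fin n → Fin n → Set
    Lead v b y = ∃ λ m → LeastPair m v b × y ≃ m

    lead? : ∀ v b y → Dec (Lead v b y)
    lead? v b y = any? λ m → (pair? m v b ×-dec all? λ i → (i <? m) →-dec ¬? (pair? i v b)) ×-dec (y ≃? m)

    free? : ∀ y → Dec (Free y)
    free? y = ¬? (y ∈? I) ×-dec all? λ v → friend? v y →-dec ¬? (rich? v)

    sole? : ∀ y v → Dec (Sole y v)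
    sole? y v = free? y ×-dec (friend? v y ×-dec all? λ u → friend? u y →-dec (u ≟ v))

    -- Which of its two friends v and b a vertex y takes: the one whose sole
    -- clients fit. If neither has sole clients, the clients of v and b form two
    -- cliques; the one of the least vertex goes to the smaller friend.
    data Prefers (y v b : Fin n) : Set where
      joined  : ∀ {e} → Sole e v → e ~ y → Prefers y v b
      blocked : ∀ {e} → Sole e b → ¬ e ~ y → Prefers y v b
      low     : (∀ {e} → ¬ Sole e v) → (∀ {e} → ¬ Sole e b) → v < b → Lead v b y → Prefers y v b
      high    : (∀ {e} → ¬ Sole e v) → (∀ {e} → ¬ Sole e b) → b < v → ¬ Lead b v y → Prefers y v b

    -- The order of the vertices breaks the symmetry: of two nonadjacent vertices with the same rich
    -- friend, the later one gives way.
    Crossing : Fin n → Fin n → Set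
    Crossing y v = ∃ λ y₀ → y₀ < y × Friend v y₀ × ¬ y ≃ y₀

    crossing? : ∀ y v → Dec (Crossing y v)
    crossing? y v = any? λ y₀ → (y₀ <? y) ×-dec (friend? v y₀ ×-dec ¬? (y ≃? y₀))

    -- In `twin`, `v` is the guard `u` of `Twins`: of the neighbours of `y` there, only `u` is a
    -- guard that is not rich.
    data Claim (y v : Fin n) : Set where
      rich  : Rich v → Friend v y → ¬ Crossing y v → Claim y v
      twin  : ∀ {v₀} → Rich v₀ → Friend v₀ y → Crossing y v₀ → ¬ Rich v → Friend v y → Claim y v
      sole  : Sole y v → Claim y v
      pair  : ∀ {b} → Twosome y v b → Prefers y v b → Claim y v

    claim⇒friend : ∀ {y v} → Claim y v → Friend v y
    claim⇒friend (rich _ f _)      = f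
    claim⇒friend (twin _ _ _ _ f)  = f
    claim⇒friend (sole (_ , f , _)) = f
    claim⇒friend (pair (v∈I , _ , bare-v , _ , _ , _ , v~y , _) _) = bare-friend v∈I bare-v v~y

    claim-exists : ∀ {y} → y ∉ I → ∃ λ v → Claim y v
    claim-exists {y} y∉I with any? (λ v → rich? v ×-dec friend? v y)
    claim-exists {y} y∉I | yes (v , rich-v , f) with crossing? y v
    ... | no ¬crossing = v , rich rich-v f ¬crossing
    ... | yes crossing@(y₀ , _ , f₀ , y≄y₀) = u , twin rich-v f crossing bare (bare-friend u∈I bare u~w₂)
      where open Twins (twins rich-v f₀ f (y≄y₀ ∘ ≃-sym))
    claim-exists {y} y∉I | no poor
      with g , f@(g∈I , g~y , _) , _ ← respond-friend y∉I
      with any? (λ b → friend? b y ×-dec ¬? (b ≟ g))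
    ... | no only = g , sole ((y∉I , λ v fv rich-v → poor (v , rich-v , fv)) , f ,
      λ u fu → decidable-stable (u ≟ g) λ u≢g → only (u , fu , u≢g))
    ... | yes (b , fb@(b∈I , b~y , _) , b≢g) = prefer
      where
      bare-g : ¬ Rich g
      bare-g rich-g = poor (g , rich-g , f)
      bare-b : ¬ Rich b
      bare-b rich-b = poor (b , rich-b , fb)
      two : Twosome y g b
      two = g∈I , b∈I , bare-g , bare-b , ≢-sym b≢g , y∉I , g~y , b~y ,
        free-within (y∉I , λ v fv rich-v → poor (v , rich-v , fv)) g∈I b∈I (≢-sym b≢g) bare-g bare-b g~y b~y
      prefer : ∃ λ v → Claim y v
      prefer with any? (λ e → sole? e g) | any? (λ e → sole? e b)
      ... | yes (e , se) | _ with e ~? y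
      ...   | yes e~y = g , pair two (joined se e~y)
      ...   | no e≁y  = b , pair (twosome-sym two) (blocked se e≁y)
      prefer | no _ | yes (e , se) with e ~? y
      ...   | yes e~y = b , pair (twosome-sym two) (joined se e~y)
      ...   | no e≁y  = g , pair two (blocked se e≁y)
      prefer | no none-g | no none-b with <-cmp g b
      ... | tri≈ _ g≡b _ = contradiction (sym g≡b) b≢g
      ... | tri< g<b _ _ with lead? g b y
      ...   | yes l = g , pair two (low (λ s → none-g (_ , s)) (λ s → none-b (_ , s)) g<b l)
      ...   | no ¬l = b , pair (twosome-sym two) (high (λ s → none-b (_ , s)) (λ s → none-g (_ , s)) g<b ¬l)
      prefer | no none-g | no none-b | tri> _ _ b<g with lead? b g y
      ...   | yes l = b , pair (twosome-sym two) (low (λ s → none-b (_ , s)) (λ s → none-g (_ , s)) b<g l)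
      ...   | no ¬l = g , pair two (high (λ s → none-g (_ , s)) (λ s → none-b (_ , s)) b<g ¬l)

    -- Nonadjacent vertices never claim the same guard

    twin-absurd : ∀ {y y′ v₀ v} → Rich v₀ → Friend v₀ y → Crossing y v₀ → ¬ Rich v → Friend v y →
      Claim y′ v → ¬ y ≃ y′ → ⊥
    twin-absurd {y} {y′} {v₀} {v} rich-v₀ f (y₀ , y₀<y , f₀ , y≄y₀) bare-v (v∈I , v~y , _) claim y≄y′ =
      absurd (subst (λ t → Claim t v) y′≡y₀ claim)
      where
      open Twins (twins rich-v₀ f₀ f (y≄y₀ ∘ ≃-sym))
      v≡u : v ≡ u
      v≡u with N-w₂ (~-sym v~y)
      ... | inj₁ refl        = contradiction rich-v₀ bare-v
      ... | inj₂ (inj₁ refl) = contradiction v∈I (proj₁ priv)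
      ... | inj₂ (inj₂ eq)   = eq
      y′≡y₀ : y′ ≡ y₀
      y′≡y₀ with N-u (subst (_~ y′) v≡u (proj₁ (proj₂ (claim⇒friend claim))))
      ... | inj₁ eq   = eq
      ... | inj₂ refl = contradiction (inj₁ refl) y≄y′
      -- The rich friend `v₀` of `y₀` excludes claims of the kinds `sole` and `pair`. A `twin` claim
      -- would need a vertex before `y₀`, not adjacent to it, among the neighbours `x`, `y₀`, `y` of
      -- `v₀`; but `y` comes later.
      absurd : Claim y₀ v → ⊥
      absurd (rich rich-v _ _)      = bare-v rich-v
      absurd (sole ((_ , poor) , _)) = poor v₀ f₀ rich-v₀
      absurd (pair (_ , _ , _ , bare-b , _ , _ , _ , _ , within) _) with within v₀ (proj₁ f₀) (proj₁ (proj₂ f₀))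
      ... | inj₁ refl = bare-v rich-v₀
      ... | inj₂ refl = bare-b rich-v₀
      absurd (twin {v₁} rich-v₁ f₁ (y₁ , y₁<y₀ , f₁₁ , y₀≄y₁) _ _) with N-w (~-sym (proj₁ (proj₂ f₁)))
      ... | inj₂ (inj₁ refl) = proj₁ priv (proj₁ f₁)
      ... | inj₂ (inj₂ refl) = bare rich-v₁
      ... | inj₁ refl with N-v (proj₁ (proj₂ f₁₁))
      ...   | inj₁ refl        = y₀≄y₁ (≃-sym (proj₂ (proj₂ f₀) y₁ priv))
      ...   | inj₂ (inj₁ refl) = y₀≄y₁ (inj₁ refl)
      ...   | inj₂ (inj₂ refl) = <-asym y₁<y₀ y₀<y

    twosome⇒≢ : ∀ {e y g b} → (∀ u → Friend u e → u ≡ g) → Twosome y g b → e ≢ y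
    twosome⇒≢ only (_ , b∈I , _ , bare-b , g≢b , _ , _ , b~y , _) refl = g≢b (sym (only _ (bare-friend b∈I bare-b b~y)))

    sole⇒≢ : ∀ {y v b z} → Sole y v → Twosome z v b → y ≢ z
    sole⇒≢ (_ , _ , only) = twosome⇒≢ only

    pair-unique : ∀ {x v b b′} → Pair x v b → Twosome x v b′ → b ≡ b′
    pair-unique (_ , _ , _ , within) (_ , b′∈I , _ , _ , v≢b′ , _ , _ , b′~x , _) with within _ b′∈I b′~x
    ... | inj₁ b′≡v = contradiction (sym b′≡v) v≢b′
    ... | inj₂ b′≡b = sym b′≡b

    parallel-two : ∀ {y v b} → Twosome y v b → ∃ λ z → Twosome z v b × ¬ z ≃ y
    parallel-two (v∈I , b∈I , bare-v , bare-b , v≢b , _ , v~y , b~y , _)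
      with z , pz , z≄y ← parallel v∈I b∈I v≢b bare-v bare-b v~y b~y =
      z , (v∈I , b∈I , bare-v , bare-b , v≢b , pz) , z≄y

    -- Otherwise `e`, `y`, `z` are pairwise nonadjacent and `e` can be answered from `v` only, so
    -- `crowd` applies.
    sole-joins : ∀ {e y z v b} → Sole e v → Twosome y v b → Twosome z v b → ¬ y ≃ z → ¬ e ~ y → e ~ z
    sole-joins {e} {y} {z} se@((e∉I , _) , _ , only) two-y@(_ , _ , _ , _ , _ , y∉I , _ , _ , within-y)
               two-z@(_ , _ , _ , _ , _ , z∉I , _ , _ , within-z) y≄z e≁y with e ~? z
    ... | yes e~z = e~z
    ... | no e≁z = ⊥-elim (crowd e∉I y∉I z∉I [ sole⇒≢ se two-y , e≁y ]′ [ sole⇒≢ se two-z , e≁z ]′ y≄z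
      (λ s f → inj₁ (only s f)) within-y within-z)

    -- The companion `z` of `y′` creates a vertex of degree four: `v` if `y′` has joined a sole
    -- client of `v`, and `z` itself if `y′` is blocked by a sole client of `b`.
    sole-pair : ∀ {y y′ v b} → Sole y v → Twosome y′ v b → Prefers y′ v b → ¬ y ≃ y′ → ⊥
    sole-pair sy _ (low ¬sole _ _ _) _  = ¬sole sy
    sole-pair sy _ (high ¬sole _ _ _) _ = ¬sole sy
    sole-pair sy@(_ , (_ , v~y , _) , _) two@(_ , _ , _ , _ , _ , _ , v~y′ , _) (joined se@(_ , (_ , v~e , _) , _) e~y′) y≄y′
      with z , two-z@(_ , _ , _ , _ , _ , _ , v~z , _) , z≄y′ ← parallel-two two =
      four-neighbours v~y v~y′ v~z v~e (y≄y′ ∘ inj₁) (sole⇒≢ sy two-z) (λ { refl → y≄y′ (inj₂ e~y′) })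
        (z≄y′ ∘ inj₁ ∘ sym) (≢-sym (sole⇒≢ se two)) (≢-sym (sole⇒≢ se two-z))
    sole-pair sy@((y∉I , _) , fy@(v∈I , _) , _) two@(_ , b∈I , _ , _ , v≢b , _)
              (blocked se@((e∉I , _) , _ , only-e) e≁y′) y≄y′
      with z , two-z@(_ , _ , _ , _ , _ , _ , v~z , b~z , _) , z≄y′ ← parallel-two two =
      four-neighbours (~-sym v~z) (~-sym b~z)
        (~-sym (sole-joins sy two two-z (z≄y′ ∘ ≃-sym) (y≄y′ ∘ inj₂)))
        (~-sym (sole-joins se (twosome-sym two) (twosome-sym two-z) (z≄y′ ∘ ≃-sym) e≁y′))
        v≢b (∉⇒≢ v∈I y∉I) (∉⇒≢ v∈I e∉I) (∉⇒≢ b∈I y∉I) (∉⇒≢ b∈I e∉I) (λ { refl → v≢b (only-e _ fy) })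

    -- By `parallel-two`, each of two different partners would account for two neighbours of `v`.
    pairs-agree : ∀ {y y′ v b b′} → Twosome y v b → Twosome y′ v b′ → ¬ y ≃ y′ → b ≡ b′
    pairs-agree {b = b} {b′} two@(_ , _ , _ , _ , _ , py@(_ , v~y , _)) two′@(_ , _ , _ , _ , _ , py′@(_ , v~y′ , _)) y≄y′ with b ≟ b′
    ... | yes b≡b′ = b≡b′
    ... | no b≢b′
      with z  , two-z@(_ , _ , _ , _ , _ , pz@(_ , v~z , _)) , z≄y ← parallel-two two
      with z′ , two-z′@(_ , _ , _ , _ , _ , (_ , v~z′ , _)) , z′≄y′ ← parallel-two two′ =
      ⊥-elim (four-neighbours v~y v~z v~y′ v~z′ (z≄y ∘ inj₁ ∘ sym) (y≄y′ ∘ inj₁)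
        (λ { refl → b≢b′ (pair-unique py two-z′) }) (λ { refl → b≢b′ (pair-unique pz two′) })
        (λ { refl → b≢b′ (pair-unique pz two-z′) }) (z′≄y′ ∘ inj₁ ∘ sym))

    joined-blocked : ∀ {y y′ v b e e₂} → Twosome y v b → Twosome y′ v b → ¬ y ≃ y′ →
      Sole e v → e ~ y → Sole e₂ b → ¬ e₂ ~ y′ → ⊥
    joined-blocked two@(v∈I , b∈I , _ , _ , v≢b , _ , v~y , b~y , _) two′ y≄y′
      se@((e∉I , _) , fe , only) e~y se₂@((e₂∉I , _) , _ , only₂) e₂≁y′ =
      four-neighbours (~-sym v~y) (~-sym b~y) (~-sym e~y)
        (~-sym (sole-joins se₂ (twosome-sym two′) (twosome-sym two) (y≄y′ ∘ ≃-sym) e₂≁y′))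
        v≢b (∉⇒≢ v∈I e∉I) (∉⇒≢ v∈I e₂∉I) (∉⇒≢ b∈I e∉I) (∉⇒≢ b∈I e₂∉I) (λ { refl → v≢b (only₂ _ fe) })

    prefers-absurd : ∀ {y y′ v b} → Twosome y v b → Twosome y′ v b → ¬ y ≃ y′ → Prefers y v b → Prefers y′ v b → ⊥
    prefers-absurd two two′ y≄y′ (joined {e} se@((e∉I , _) , (_ , v~e , _) , _) e~y) (joined {e₂} se₂@(_ , (_ , v~e₂ , _) , _) e₂~y′)
      with e ≟ e₂ | two | two′
    ... | no e≢e₂ | (_ , _ , _ , _ , _ , _ , v~y , _) | (_ , _ , _ , _ , _ , _ , v~y′ , _) =
      four-neighbours v~y v~y′ v~e v~e₂ (y≄y′ ∘ inj₁) (≢-sym (sole⇒≢ se two)) (≢-sym (sole⇒≢ se₂ two))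
        (≢-sym (sole⇒≢ se two′)) (≢-sym (sole⇒≢ se₂ two′)) e≢e₂
    -- The common sole client `e` is not private to the bare guard `v`; a second guard `c` beside it
    -- gives `e` four neighbours.
    ... | yes refl | (v∈I , _ , bare-v , _ , _ , y∉I , _) | (_ , _ , _ , _ , _ , y′∉I , _)
      with c , c∈I , c~e , c≢v ← second-guard e∉I v~e (λ priv → bare-v (e , priv)) =
      four-neighbours (~-sym v~e) (~-sym c~e) e~y e₂~y′ (≢-sym c≢v) (∉⇒≢ v∈I y∉I) (∉⇒≢ v∈I y′∉I)
        (∉⇒≢ c∈I y∉I) (∉⇒≢ c∈I y′∉I) (y≄y′ ∘ inj₁)
    prefers-absurd two two′ y≄y′ (joined se e~y) (blocked se₂ e₂≁y′) = joined-blocked two two′ y≄y′ se e~y se₂ e₂≁y′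
    prefers-absurd two two′ y≄y′ (blocked se e≁y) (joined se₂ e₂~y′) = joined-blocked two′ two (y≄y′ ∘ ≃-sym) se₂ e₂~y′ se e≁y
    prefers-absurd two@(_ , _ , _ , _ , _ , _ , _ , b~y , _) two′@(_ , _ , _ , _ , _ , _ , _ , b~y′ , _) y≄y′
      (blocked se@(_ , (_ , b~e , _) , _) e≁y) (blocked se₂@(_ , (_ , b~e₂ , _) , _) e₂≁y′) =
      four-neighbours b~y b~y′ b~e b~e₂ (y≄y′ ∘ inj₁)
        (≢-sym (sole⇒≢ se (twosome-sym two))) (≢-sym (sole⇒≢ se₂ (twosome-sym two)))
        (≢-sym (sole⇒≢ se (twosome-sym two′))) (≢-sym (sole⇒≢ se₂ (twosome-sym two′)))
        (λ { refl → e₂≁y′ (sole-joins se (twosome-sym two) (twosome-sym two′) y≄y′ e≁y) })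
    prefers-absurd _ _ _ (joined se _)  (low ¬sole _ _ _)  = ¬sole se
    prefers-absurd _ _ _ (joined se _)  (high ¬sole _ _ _) = ¬sole se
    prefers-absurd _ _ _ (blocked se _) (low _ ¬sole _ _)  = ¬sole se
    prefers-absurd _ _ _ (blocked se _) (high _ ¬sole _ _) = ¬sole se
    prefers-absurd _ _ _ (low ¬sole _ _ _)  (joined se _)  = ¬sole se
    prefers-absurd _ _ _ (high ¬sole _ _ _) (joined se _)  = ¬sole se
    prefers-absurd _ _ _ (low _ ¬sole _ _)  (blocked se _) = ¬sole se
    prefers-absurd _ _ _ (high _ ¬sole _ _) (blocked se _) = ¬sole se
    prefers-absurd _ _ _ (low _ _ v<b _)  (high _ _ b<v _) = <-asym v<b b<v
    prefers-absurd _ _ _ (high _ _ b<v _) (low _ _ v<b _)  = <-asym v<b b<v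
    -- Both `y` and `y′` are near the least vertex `m` between `v` and `b`; unless one of them is
    -- `m`, they are its third and fourth neighbours.
    prefers-absurd two@(v∈I , b∈I , _ , _ , v≢b , y∉I , _) (_ , _ , _ , _ , _ , y′∉I , _) y≄y′
      (low _ _ _ (m , (pm@(_ , v~m , b~m , _) , below) , y≃m)) (low _ _ _ (m′ , (pm′ , below′) , y′≃m′)) with <-cmp m m′
    ... | tri< m<m′ _ _ = below′ m m<m′ pm
    ... | tri> _ _ m′<m = below m′ m′<m pm′
    ... | tri≈ _ refl _ with y≃m | y′≃m′
    ...   | inj₁ refl | _         = y≄y′ (≃-sym y′≃m′)
    ...   | inj₂ _    | inj₁ refl = y≄y′ y≃m
    ...   | inj₂ y~m  | inj₂ y′~m = four-neighbours (~-sym v~m) (~-sym b~m) (~-sym y~m) (~-sym y′~m)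
            v≢b (∉⇒≢ v∈I y∉I) (∉⇒≢ v∈I y′∉I) (∉⇒≢ b∈I y∉I) (∉⇒≢ b∈I y′∉I) (y≄y′ ∘ inj₁)
    -- Neither vertex is near `m`, so `m`, `y` and `y′` would be three pairwise nonadjacent vertices
    -- served by two guards.
    prefers-absurd {y} {y′} {v} {b} two@(_ , _ , _ , _ , _ , py@(y∉I , _ , _ , within-y)) (_ , _ , _ , _ , _ , y′∉I , _ , _ , within-y′) y≄y′
      (high _ _ _ ¬lead) (high _ _ _ ¬lead′)
      with m , pm@(m∉I , _ , _ , within-m) , below ← least (λ i → pair? i b v) (y , pair-sym py) =
      crowd m∉I y∉I y′∉I (λ m≃y → ¬lead (m , (pm , below) , ≃-sym m≃y)) (λ m≃y′ → ¬lead′ (m , (pm , below) , ≃-sym m≃y′)) y≄y′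
        (λ { s (s∈I , s~m , _) → swap (within-m s s∈I s~m) }) within-y within-y′

    bare-sole : ∀ {y v} → Sole y v → ¬ Rich v
    bare-sole ((_ , poor) , f , _) = poor _ f

    claims-absurd : ∀ {y y′ v} → Claim y v → Claim y′ v → ¬ y ≃ y′ → ⊥
    claims-absurd (twin r₀ f₀ c bare-v f) claim′ y≄y′ = twin-absurd r₀ f₀ c bare-v f claim′ y≄y′
    claims-absurd claim (twin r₀ f₀ c bare-v f) y≄y′  = twin-absurd r₀ f₀ c bare-v f claim (y≄y′ ∘ ≃-sym)
    claims-absurd {y} {y′} (rich _ f ¬c) (rich _ f′ ¬c′) y≄y′ with <-cmp y y′
    ... | tri< y<y′ _ _ = ¬c′ (y , y<y′ , f , y≄y′ ∘ ≃-sym)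
    ... | tri≈ _ y≡y′ _ = y≄y′ (inj₁ y≡y′)
    ... | tri> _ _ y′<y = ¬c (y′ , y′<y , f′ , y≄y′)
    claims-absurd (rich r _ _) (sole s) _ = bare-sole s r
    claims-absurd (sole s) (rich r _ _) _ = bare-sole s r
    claims-absurd (rich r _ _) (pair (_ , _ , bare-v , _) _) _ = bare-v r
    claims-absurd (pair (_ , _ , bare-v , _) _) (rich r _ _) _ = bare-v r
    claims-absurd (sole s) (sole s′) y≄y′ = y≄y′ (sole-adjacent s s′)
    claims-absurd (sole s) (pair two prefers) y≄y′ = sole-pair s two prefers y≄y′
    claims-absurd (pair two prefers) (sole s) y≄y′ = sole-pair s two prefers (y≄y′ ∘ ≃-sym)
    claims-absurd (pair two prefers) (pair two′ prefers′) y≄y′ with refl ← pairs-agree two two′ y≄y′ =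
      prefers-absurd two two′ y≄y′ prefers prefers′

    -- The clique partition

    Keeper : Fin n → Fin n → Set
    Keeper y v = v ≡ y ⊎ Claim y v

    keeper : ∀ y → ∃ λ v → v ∈ I × Keeper y v
    keeper y with y ∈? I
    ... | yes y∈I = y , y∈I , inj₁ refl
    ... | no y∉I with v , claim ← claim-exists y∉I = v , proj₁ (claim⇒friend claim) , inj₂ claim

    keeper-clique : ∀ {y y′ v} → Keeper y v → Keeper y′ v → y ≃ y′
    keeper-clique (inj₁ refl) (inj₁ refl)   = inj₁ refl
    keeper-clique (inj₁ refl) (inj₂ claim′) = inj₂ (proj₁ (proj₂ (claim⇒friend claim′)))
    keeper-clique (inj₂ claim) (inj₁ refl)  = inj₂ (~-sym (proj₁ (proj₂ (claim⇒friend claim))))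
    keeper-clique {y} {y′} (inj₂ claim) (inj₂ claim′) = decidable-stable (y ≃? y′) (claims-absurd claim claim′)

    clique-partition : HasCliquePartition G ∣ I ∣
    clique-partition = part , clique
      where
      slot : ∀ y → ∃ λ i → member I i ≡ proj₁ (keeper y)
      slot y = index (proj₁ (proj₂ (keeper y)))

      part : Fin n → Fin ∣ I ∣
      part y = proj₁ (slot y)

      clique : IsCliquePartition G part
      clique y y′ eq y≢y′ = [ (λ y≡y′ → contradiction y≡y′ y≢y′) , (λ y~y′ → y~y′) ]′
        (keeper-clique (proj₂ (proj₂ (keeper y)))
          (subst (Keeper y′) (trans (sym (proj₂ (slot y′))) (trans (cong (member I) (sym eq)) (proj₂ (slot y))))
            (proj₂ (proj₂ (keeper y′)))))

theorem6p3 : (n : ℕ) (G : Graph n) → γ G ≡ γ∞ G → Δ G ≤ 3 → γ∞ G ≡ θ G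
theorem6p3 n G γ≡γ∞ Δ≤3 = ℕ.≤-antisym γ∞≤θ θ≤γ∞
  where
  γ∞≤ : ∀ D → Dominating G D → γ∞ G ≤ ∣ D ∣
  γ∞≤ D dom = subst (_≤ ∣ D ∣) γ≡γ∞ (proj₂ (γ-isMinimum G) (D , refl , dom))

  γ∞≤θ : γ∞ G ≤ θ G
  γ∞≤θ = let D , ∣D∣≤θ , dom = clique-partition⇒dominating G (proj₁ (θ-isMinimum G))
         in ℕ.≤-trans (γ∞≤ D dom) ∣D∣≤θ

  open Play G (λ v → ℕ.≤-trans (degree≤Δ G v) Δ≤3) (γ∞ G) γ∞≤

  θ≤γ∞ : θ G ≤ γ∞ G
  θ≤γ∞ = let D , ∣D∣≡γ∞ , eternal = proj₁ (γ∞-isMinimum G)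
             I , win , indep = independent-winning (winning eternal (ℕ.≤-reflexive ∣D∣≡γ∞))
         in ℕ.≤-trans (proj₂ (θ-isMinimum G) (Position.clique-partition I win indep)) (Winning.size win)
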